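{- Let $n\ge 1$ be an integer, and let $P$ be a homogeneous multilinear polynomial with complex coefficients which has exactly $n$ monomial terms (with nonzero coefficients), has total degree at least two, and has totally non-overlapping monomial support (that is, no variable occurs in two distinct monomial terms of $P$). Then the Chow rank of $P$ is exactly $n$.
   Context: All polynomials are over $\mathbb{C}$. For a polynomial $P\in\mathbb{C}[x_0,\dots,x_{N-1}]$ of degree $d\ge 1$, the Chow rank of $P$ is the smallest number $\rho$ of summands in an expression of the form $$P(\boldsymbol{x})=\sum_{u=0}^{\rho-1}\ \prod_{v=0}^{d-1} \ell_{u,v}(x_0,\dots,x_{N-1}),\qquad \ell_{u,v}=H_{u,v,N}+\sum_{w=0}^{N-1}H_{u,v,w}\,x_w ,$$ with $H\in\mathbb{C}^{\rho\times d\times (N+1)}$; the $\ell_{u,v}$ are thus arbitrary, possibly non-homogeneous, linear (affine) forms. A polynomial is multilinear if each variable has degree at most one in each monomial. After relabelling of variables, a homogeneous multilinear polynomial of degree $m$ with $n$ terms and totally non-overlapping monomial support has the form $\sum_{i=0}^{n-1}\alpha_i\prod_{j=0}^{m-1}x_{mi+j}$ with all $\alpha_i\in\mathbb{C}\setminus\{0\}$. -}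

module Defs where

open import Algebra.Bundles using (CommutativeRing)
import Algebra.Solver.Ring.NaturalCoefficients.Default as SemiringSolver
open import Algebra.Structures using (IsCommutativeRing)
open import Data.Fin.Base using (Fin; fromℕ; inject₁)
open import Data.List.Base using (List; []; _∷_; _++_; length; cartesianProductWith)
open import Data.List.Membership.Propositional using (_∈_)
open import Data.List.Relation.Unary.Unique.Propositional using (Unique)
open import Data.Nat.Base as ℕ using (ℕ; suc; _≤_; _<_; _⊔_)
import Data.Nat.Properties as ℕ
open import Data.Product.Base using (_×_; _,_; ∃; ∃-syntax)
open import Data.Rational.Base as ℚ using (ℚ; 0ℚ; 1ℚ; ½; ∣_∣)
import Data.Rational.Properties as ℚ
open import Data.Rational.Solver using (module +-*-Solver)
open import Data.Vec.Base as Vec using (Vec; lookup; replicate; zipWith; _[_]≔_)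
open import Data.Vec.Functional as Vector using (Vector)
open import Data.Vec.Properties using (≡-dec)
open import Data.Bool.Base using (if_then_else_)
open import Function.Bundles using (_⇔_)
open import Level using (0ℓ) renaming (_⊔_ to _⊔ˡ_)
open import Relation.Binary.PropositionalEquality
  using (_≡_; _≢_; refl; sym; trans; cong; subst)
open import Relation.Nullary using (¬_; does)

------------------------------------------------------------------------
-- R[i] = R[t]/(t² + 1), with a + bi encoded as the pair (a , b).

module Adjoin-i {c ℓ} (R : CommutativeRing c ℓ) where
  private
    module R = CommutativeRing R
    module S = SemiringSolver R.commutativeSemiring
    open S using (_:=_; _:+_; _:*_)
    open import Algebra.Properties.Ring R.ring using (-0#≈0#; -1*x≈-x)
  open R using (_≈_; _+_; _*_; -_; 0#; 1#)

  adjoin-i : CommutativeRing c ℓ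
  adjoin-i = record
    { Carrier = R.Carrier × R.Carrier
    ; _≈_ = λ (a , b) (a′ , b′) → (a ≈ a′) × (b ≈ b′)
    ; _+_ = λ (a , b) (a′ , b′) → (a + a′) , (b + b′)
    ; _*_ = λ (a , b) (a′ , b′) → (a * a′ + - (b * b′)) , (a * b′ + b * a′)
    ; -_  = λ (a , b) → (- a) , (- b)
    ; 0#  = 0# , 0#
    ; 1#  = 1# , 0#
    ; isCommutativeRing = record
      { isRing = record
        { +-isAbelianGroup = record
          { isGroup = record
            { isMonoid = record
              { isSemigroup = record
                { isMagma = record
                  { isEquivalence = record
                    { refl  = R.refl , R.refl
                    ; sym   = λ (p , q) → R.sym p , R.sym q
                    ; trans = λ (p , q) (p′ , q′) → R.trans p p′ , R.trans q q′
                    }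
                  ; ∙-cong = λ (p , q) (p′ , q′) → R.+-cong p p′ , R.+-cong q q′
                  }
                ; assoc = λ (a , b) (c , d) (e , f) → R.+-assoc a c e , R.+-assoc b d f
                }
              ; identity = (λ (a , b) → R.+-identityˡ a , R.+-identityˡ b)
                         , (λ (a , b) → R.+-identityʳ a , R.+-identityʳ b)
              }
            ; inverse = (λ (a , b) → R.-‿inverseˡ a , R.-‿inverseˡ b)
                      , (λ (a , b) → R.-‿inverseʳ a , R.-‿inverseʳ b)
            ; ⁻¹-cong = λ (p , q) → R.-‿cong p , R.-‿cong q
            }
          ; comm = λ (a , b) (c , d) → R.+-comm a c , R.+-comm b d
          }
        ; *-cong = λ (p , q) (p′ , q′) →
              R.+-cong (R.*-cong p p′) (R.-‿cong (R.*-cong q q′))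
            , R.+-cong (R.*-cong p q′) (R.*-cong q p′)
        ; *-assoc = assoc
        ; *-identity = idˡ , λ z → ≈-trans (comm z _) (idˡ z)
        ; distrib = distˡ , λ x y z →
            ≈-trans (comm (y ⊞ z) x)
              (≈-trans (distˡ x y z) (⊞-cong (comm x y) (comm x z)))
        }
      ; *-comm = comm
      }
    }
    where
    C : Set c
    C = R.Carrier × R.Carrier
    _≋_ : C → C → Set ℓ
    (a , b) ≋ (a′ , b′) = (a ≈ a′) × (b ≈ b′)
    _⊞_ _⊠_ : C → C → C
    (a , b) ⊞ (a′ , b′) = (a + a′) , (b + b′)
    (a , b) ⊠ (a′ , b′) = (a * a′ + - (b * b′)) , (a * b′ + b * a′)
    ≈-trans : ∀ {x y z} → x ≋ y → y ≋ z → x ≋ z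
    ≈-trans (p , q) (p′ , q′) = R.trans p p′ , R.trans q q′
    ⊞-cong : ∀ {x x′ y y′} → x ≋ x′ → y ≋ y′ → (x ⊞ y) ≋ (x′ ⊞ y′)
    ⊞-cong (p , q) (p′ , q′) = R.+-cong p p′ , R.+-cong q q′
    comm : ∀ x y → (x ⊠ y) ≋ (y ⊠ x)
    comm (a , b) (c , d) =
        R.+-cong (R.*-comm a c) (R.-‿cong (R.*-comm b d))
      , R.trans (R.+-comm _ _) (R.+-cong (R.*-comm b c) (R.*-comm a d))
    neg : ∀ x → - x ≈ - 1# * x
    neg x = R.sym (-1*x≈-x x)
    assoc : ∀ x y z → ((x ⊠ y) ⊠ z) ≋ (x ⊠ (y ⊠ z))
    assoc (a , b) (c , d) (e , f) =
        R.trans (R.+-cong (R.*-congʳ (R.+-congˡ (neg _))) (neg _))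
          (R.trans
            (S.solve 7 (λ a b c d e f k →
              ((((a :* c) :+ (k :* (b :* d))) :* e) :+ (k :* (((a :* d) :+ (b :* c)) :* f)))
              := ((a :* ((c :* e) :+ (k :* (d :* f)))) :+ (k :* (b :* ((c :* f) :+ (d :* e))))))
              R.refl a b c d e f (- 1#))
            (R.sym (R.+-cong (R.*-congˡ (R.+-congˡ (neg _))) (neg _))))
      , R.trans (R.+-congʳ (R.*-congʳ (R.+-congˡ (neg _))))
          (R.trans
            (S.solve 7 (λ a b c d e f k →
              ((((a :* c) :+ (k :* (b :* d))) :* f) :+ (((a :* d) :+ (b :* c)) :* e))
              := ((a :* ((c :* f) :+ (d :* e))) :+ (b :* ((c :* e) :+ (k :* (d :* f))))))
              R.refl a b c d e f (- 1#))
            (R.sym (R.+-congˡ (R.*-congˡ (R.+-congˡ (neg _))))))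
    idˡ : ∀ x → ((1# , 0#) ⊠ x) ≋ x
    idˡ (a , b) =
        R.trans (R.+-cong (R.*-identityˡ a)
                          (R.trans (R.-‿cong (R.zeroˡ b)) -0#≈0#)) (R.+-identityʳ a)
      , R.trans (R.+-cong (R.*-identityˡ b) (R.zeroˡ a)) (R.+-identityʳ b)
    distˡ : ∀ x y z → (x ⊠ (y ⊞ z)) ≋ ((x ⊠ y) ⊞ (x ⊠ z))
    distˡ (a , b) (c , d) (e , f) =
        R.trans (R.+-congˡ (neg _))
          (R.trans
            (S.solve 7 (λ a b c d e f k →
              ((a :* (c :+ e)) :+ (k :* (b :* (d :+ f))))
              := (((a :* c) :+ (k :* (b :* d))) :+ ((a :* e) :+ (k :* (b :* f)))))
              R.refl a b c d e f (- 1#))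
            (R.sym (R.+-cong (R.+-congˡ (neg _)) (R.+-congˡ (neg _)))))
      , S.solve 6 (λ a b c d e f →
          ((a :* (d :+ f)) :+ (b :* (c :+ e)))
          := (((a :* d) :+ (b :* c)) :+ ((a :* f) :+ (b :* e))))
          R.refl a b c d e f

------------------------------------------------------------------------
-- Real numbers: rational Cauchy sequences, with the setoid equality
-- "the difference tends to 0".

Vanishes : (ℕ → ℕ → ℚ) → Set
Vanishes h =
  ∀ ε → 0ℚ ℚ.< ε → ∃[ k ] (∀ m n → k ≤ m → k ≤ n → ∣ h m n ∣ ℚ.< ε)

record ℝ : Set where
  constructor mkℝ
  field
    seq    : ℕ → ℚ
    cauchy : Vanishes (λ m n → seq m ℚ.- seq n)

open ℝ public

infix 4 _≈ᵣ_

_≈ᵣ_ : ℝ → ℝ → Set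
x ≈ᵣ y =
  ∀ ε → 0ℚ ℚ.< ε → ∃[ k ] (∀ n → k ≤ n → ∣ seq x n ℚ.- seq y n ∣ ℚ.< ε)

module Vanishes-Properties where
  open +-*-Solver using (solve; _:+_; _:*_; _:-_; :-_; _:=_; con)

  toV : ∀ {x y} → x ≈ᵣ y → Vanishes (λ m _ → seq x m ℚ.- seq y m)
  toV p ε ε>0 with p ε ε>0
  ... | k , q = k , λ m _ k≤m _ → q m k≤m

  fromV : ∀ {x y} → Vanishes (λ m _ → seq x m ℚ.- seq y m) → x ≈ᵣ y
  fromV p ε ε>0 with p ε ε>0
  ... | k , q = k , λ n k≤n → q n n k≤n k≤n

  V-ext : ∀ {g h} → (∀ m n → g m n ≡ h m n) → Vanishes g → Vanishes h
  V-ext g≡h p ε ε>0 with p ε ε>0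
  ... | k , q = k , λ m n k≤m k≤n →
    subst (λ z → ∣ z ∣ ℚ.< ε) (g≡h m n) (q m n k≤m k≤n)

  V-zero : ∀ {h} → (∀ m n → h m n ≡ 0ℚ) → Vanishes h
  V-zero h≡0 = V-ext (λ m n → sym (h≡0 m n)) (λ ε ε>0 → 0 , λ _ _ _ _ → ε>0)

  ½-pos : ∀ {ε} → 0ℚ ℚ.< ε → 0ℚ ℚ.< ½ ℚ.* ε
  ½-pos {ε} ε>0 = subst (ℚ._< ½ ℚ.* ε) (ℚ.*-zeroʳ ½) (ℚ.*-monoʳ-<-pos ½ ε>0)

  ½+½ : ∀ ε → ½ ℚ.* ε ℚ.+ ½ ℚ.* ε ≡ ε
  ½+½ = solve 1 (λ e → con ½ :* e :+ con ½ :* e := e) refl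

  V-+ : ∀ {g h} → Vanishes g → Vanishes h → Vanishes (λ m n → g m n ℚ.+ h m n)
  V-+ {g} {h} p q ε ε>0 with p (½ ℚ.* ε) (½-pos ε>0) | q (½ ℚ.* ε) (½-pos ε>0)
  ... | k , p′ | l , q′ = k ⊔ l , λ m n m≥ n≥ → begin-strict
    ∣ g m n ℚ.+ h m n ∣        ≤⟨ ℚ.∣p+q∣≤∣p∣+∣q∣ (g m n) (h m n) ⟩
    ∣ g m n ∣ ℚ.+ ∣ h m n ∣    <⟨ ℚ.+-mono-<
                                    (p′ m n (ℕ.m⊔n≤o⇒m≤o k l m≥) (ℕ.m⊔n≤o⇒m≤o k l n≥))
                                    (q′ m n (ℕ.m⊔n≤o⇒n≤o k l m≥) (ℕ.m⊔n≤o⇒n≤o k l n≥)) ⟩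
    ½ ℚ.* ε ℚ.+ ½ ℚ.* ε        ≡⟨ ½+½ ε ⟩
    ε ∎
    where open ℚ.≤-Reasoning

  V-neg : ∀ {h} → Vanishes h → Vanishes (λ m n → ℚ.- h m n)
  V-neg {h} p ε ε>0 with p ε ε>0
  ... | k , q = k , λ m n k≤m k≤n →
    subst (ℚ._< ε) (sym (ℚ.∣-p∣≡∣p∣ (h m n))) (q m n k≤m k≤n)

  Bounded : (ℕ → ℕ → ℚ) → Set
  Bounded h =
    ∃[ B ] ℚ.Positive B × ∃[ k ] (∀ m n → k ≤ m → k ≤ n → ∣ h m n ∣ ℚ.≤ B)

  V-* : ∀ {g h} → Bounded g → Vanishes h → Vanishes (λ m n → g m n ℚ.* h m n)
  V-* {g} {h} (B , B>0 , k , b) p ε ε>0 = go (p δ δ>0)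
    where
    open ℚ.≤-Reasoning
    instance
      B-pos : ℚ.Positive B
      B-pos = B>0
      B-nonNeg : ℚ.NonNegative B
      B-nonNeg = ℚ.pos⇒nonNeg B
      B-nonZero : ℚ.NonZero B
      B-nonZero = ℚ.pos⇒nonZero B
      B⁻¹-pos : ℚ.Positive (ℚ.1/ B)
      B⁻¹-pos = ℚ.1/pos⇒pos B
    δ = (ℚ.1/ B) ℚ.* ε
    δ>0 : 0ℚ ℚ.< δ
    δ>0 = subst (ℚ._< δ) (ℚ.*-zeroʳ (ℚ.1/ B)) (ℚ.*-monoʳ-<-pos (ℚ.1/ B) ε>0)
    Bδ≡ε : B ℚ.* δ ≡ ε
    Bδ≡ε = trans (sym (ℚ.*-assoc B (ℚ.1/ B) ε))
             (trans (cong (ℚ._* ε) (ℚ.*-inverseʳ B)) (ℚ.*-identityˡ ε))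
    go : ∃[ l ] (∀ m n → l ≤ m → l ≤ n → ∣ h m n ∣ ℚ.< δ) →
         ∃[ l ] (∀ m n → l ≤ m → l ≤ n → ∣ g m n ℚ.* h m n ∣ ℚ.< ε)
    go (l , q) = k ⊔ l , λ m n m≥ n≥ → begin-strict
      ∣ g m n ℚ.* h m n ∣      ≡⟨ ℚ.∣p*q∣≡∣p∣*∣q∣ (g m n) (h m n) ⟩
      ∣ g m n ∣ ℚ.* ∣ h m n ∣  ≤⟨ ℚ.*-monoʳ-≤-nonNeg ∣ h m n ∣ {{ℚ.∣-∣-nonNeg (h m n)}}
                                    (b m n (ℕ.m⊔n≤o⇒m≤o k l m≥) (ℕ.m⊔n≤o⇒m≤o k l n≥)) ⟩
      B ℚ.* ∣ h m n ∣          <⟨ ℚ.*-monoʳ-<-pos B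
                                    (q m n (ℕ.m⊔n≤o⇒n≤o k l m≥) (ℕ.m⊔n≤o⇒n≤o k l n≥)) ⟩
      B ℚ.* δ                  ≡⟨ Bδ≡ε ⟩
      ε ∎

  ∣seq∣-bounded : ∀ x →
    ∃[ B ] ℚ.Positive B × ∃[ k ] (∀ m → k ≤ m → ∣ seq x m ∣ ℚ.≤ B)
  ∣seq∣-bounded x with cauchy x 1ℚ (ℚ.positive⁻¹ 1ℚ)
  ... | k , c = 1ℚ ℚ.+ ∣ seq x k ∣
              , ℚ.pos+nonNeg⇒pos 1ℚ ∣ seq x k ∣ {{ℚ.∣-∣-nonNeg (seq x k)}}
              , k , λ m k≤m → begin
    ∣ seq x m ∣                                  ≡⟨ cong ∣_∣ (split (seq x m) (seq x k)) ⟩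
    ∣ (seq x m ℚ.- seq x k) ℚ.+ seq x k ∣        ≤⟨ ℚ.∣p+q∣≤∣p∣+∣q∣ (seq x m ℚ.- seq x k) (seq x k) ⟩
    ∣ seq x m ℚ.- seq x k ∣ ℚ.+ ∣ seq x k ∣      ≤⟨ ℚ.+-monoˡ-≤ ∣ seq x k ∣
                                                      (ℚ.<⇒≤ (c m k k≤m ℕ.≤-refl)) ⟩
    1ℚ ℚ.+ ∣ seq x k ∣ ∎
    where
    open ℚ.≤-Reasoning
    split : ∀ p q → p ≡ (p ℚ.- q) ℚ.+ q
    split = solve 2 (λ p q → p := (p :- q) :+ q) refl

  boundedˡ : ∀ x → Bounded (λ m _ → seq x m)
  boundedˡ x = let B , B>0 , k , b = ∣seq∣-bounded x in
    B , B>0 , k , λ m _ k≤m _ → b m k≤m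

  boundedʳ : ∀ x → Bounded (λ _ n → seq x n)
  boundedʳ x = let B , B>0 , k , b = ∣seq∣-bounded x in
    B , B>0 , k , λ _ n _ k≤n → b n k≤n

  +-diff : ∀ a b c d → (a ℚ.- c) ℚ.+ (b ℚ.- d) ≡ (a ℚ.+ b) ℚ.- (c ℚ.+ d)
  +-diff = solve 4 (λ a b c d → (a :- c) :+ (b :- d) := (a :+ b) :- (c :+ d)) refl

  neg-diff : ∀ a b → ℚ.- (a ℚ.- b) ≡ (ℚ.- a) ℚ.- (ℚ.- b)
  neg-diff = solve 2 (λ a b → :- (a :- b) := (:- a) :- (:- b)) refl

  *-diff : ∀ a b c d →
    a ℚ.* (b ℚ.- d) ℚ.+ d ℚ.* (a ℚ.- c) ≡ (a ℚ.* b) ℚ.- (c ℚ.* d)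
  *-diff = solve 4 (λ a b c d →
    a :* (b :- d) :+ d :* (a :- c) := (a :* b) :- (c :* d)) refl

open Vanishes-Properties

infixl 7 _*ᵣ_
infixl 6 _+ᵣ_
infix  8 -ᵣ_

fromℚ : ℚ → ℝ
fromℚ q = mkℝ (λ _ → q) (V-zero (λ _ _ → ℚ.+-inverseʳ q))

_+ᵣ_ : ℝ → ℝ → ℝ
x +ᵣ y = mkℝ (λ n → seq x n ℚ.+ seq y n)
  (V-ext (λ m n → +-diff (seq x m) (seq y m) (seq x n) (seq y n))
    (V-+ (cauchy x) (cauchy y)))

_*ᵣ_ : ℝ → ℝ → ℝ
x *ᵣ y = mkℝ (λ n → seq x n ℚ.* seq y n)
  (V-ext (λ m n → *-diff (seq x m) (seq y m) (seq x n) (seq y n))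
    (V-+ (V-* (boundedˡ x) (cauchy y)) (V-* (boundedʳ y) (cauchy x))))

-ᵣ_ : ℝ → ℝ
-ᵣ x = mkℝ (λ n → ℚ.- seq x n)
  (V-ext (λ m n → neg-diff (seq x m) (seq x n)) (V-neg (cauchy x)))

module ≈ᵣ-Properties where
  open +-*-Solver using (solve; _:-_; :-_; _:+_; _:=_)

  pointwise : ∀ x y → (∀ n → seq x n ≡ seq y n) → x ≈ᵣ y
  pointwise x y x≡y = fromV {x} {y}
    (V-zero (λ m _ → trans (cong (ℚ._- seq y m) (x≡y m)) (ℚ.+-inverseʳ (seq y m))))

  ≈ᵣ-sym : ∀ {x y} → x ≈ᵣ y → y ≈ᵣ x
  ≈ᵣ-sym {x} {y} p = fromV {y} {x}
    (V-ext (λ m _ → flip-diff (seq x m) (seq y m)) (V-neg (toV {x} {y} p)))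
    where
    flip-diff : ∀ a b → ℚ.- (a ℚ.- b) ≡ b ℚ.- a
    flip-diff = solve 2 (λ a b → :- (a :- b) := b :- a) refl

  ≈ᵣ-trans : ∀ {x y z} → x ≈ᵣ y → y ≈ᵣ z → x ≈ᵣ z
  ≈ᵣ-trans {x} {y} {z} p q = fromV {x} {z}
    (V-ext (λ m _ → join-diff (seq x m) (seq y m) (seq z m))
      (V-+ (toV {x} {y} p) (toV {y} {z} q)))
    where
    join-diff : ∀ a b c → (a ℚ.- b) ℚ.+ (b ℚ.- c) ≡ a ℚ.- c
    join-diff = solve 3 (λ a b c → (a :- b) :+ (b :- c) := a :- c) refl

  +ᵣ-cong : ∀ {x x′ y y′} → x ≈ᵣ x′ → y ≈ᵣ y′ → x +ᵣ y ≈ᵣ x′ +ᵣ y′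
  +ᵣ-cong {x} {x′} {y} {y′} p q = fromV {x +ᵣ y} {x′ +ᵣ y′}
    (V-ext (λ m _ → +-diff (seq x m) (seq y m) (seq x′ m) (seq y′ m))
      (V-+ (toV {x} {x′} p) (toV {y} {y′} q)))

  *ᵣ-cong : ∀ {x x′ y y′} → x ≈ᵣ x′ → y ≈ᵣ y′ → x *ᵣ y ≈ᵣ x′ *ᵣ y′
  *ᵣ-cong {x} {x′} {y} {y′} p q = fromV {x *ᵣ y} {x′ *ᵣ y′}
    (V-ext (λ m _ → *-diff (seq x m) (seq y m) (seq x′ m) (seq y′ m))
      (V-+ (V-* (boundedˡ x) (toV {y} {y′} q))
           (V-* (boundedˡ y′) (toV {x} {x′} p))))

  -ᵣ-cong : ∀ {x y} → x ≈ᵣ y → -ᵣ x ≈ᵣ -ᵣ y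
  -ᵣ-cong {x} {y} p = fromV { -ᵣ x} { -ᵣ y}
    (V-ext (λ m _ → neg-diff (seq x m) (seq y m)) (V-neg (toV {x} {y} p)))

open ≈ᵣ-Properties

ℝ-isCommutativeRing : IsCommutativeRing _≈ᵣ_ _+ᵣ_ _*ᵣ_ -ᵣ_ (fromℚ 0ℚ) (fromℚ 1ℚ)
ℝ-isCommutativeRing = record
  { isRing = record
    { +-isAbelianGroup = record
      { isGroup = record
        { isMonoid = record
          { isSemigroup = record
            { isMagma = record
              { isEquivalence = record
                { refl  = λ {x} → pointwise x x (λ _ → refl)
                ; sym   = λ {x} {y} → ≈ᵣ-sym {x} {y}
                ; trans = λ {x} {y} {z} → ≈ᵣ-trans {x} {y} {z}
                }
              ; ∙-cong = λ {x} {x′} {y} {y′} → +ᵣ-cong {x} {x′} {y} {y′}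
              }
            ; assoc = λ x y z → pointwise ((x +ᵣ y) +ᵣ z) (x +ᵣ (y +ᵣ z))
                (λ n → ℚ.+-assoc (seq x n) (seq y n) (seq z n))
            }
          ; identity =
              (λ x → pointwise (fromℚ 0ℚ +ᵣ x) x (λ n → ℚ.+-identityˡ (seq x n)))
            , (λ x → pointwise (x +ᵣ fromℚ 0ℚ) x (λ n → ℚ.+-identityʳ (seq x n)))
          }
        ; inverse =
            (λ x → pointwise ((-ᵣ x) +ᵣ x) (fromℚ 0ℚ) (λ n → ℚ.+-inverseˡ (seq x n)))
          , (λ x → pointwise (x +ᵣ (-ᵣ x)) (fromℚ 0ℚ) (λ n → ℚ.+-inverseʳ (seq x n)))
        ; ⁻¹-cong = λ {x} {y} → -ᵣ-cong {x} {y}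
        }
      ; comm = λ x y → pointwise (x +ᵣ y) (y +ᵣ x)
          (λ n → ℚ.+-comm (seq x n) (seq y n))
      }
    ; *-cong = λ {x} {x′} {y} {y′} → *ᵣ-cong {x} {x′} {y} {y′}
    ; *-assoc = λ x y z → pointwise ((x *ᵣ y) *ᵣ z) (x *ᵣ (y *ᵣ z))
        (λ n → ℚ.*-assoc (seq x n) (seq y n) (seq z n))
    ; *-identity =
        (λ x → pointwise (fromℚ 1ℚ *ᵣ x) x (λ n → ℚ.*-identityˡ (seq x n)))
      , (λ x → pointwise (x *ᵣ fromℚ 1ℚ) x (λ n → ℚ.*-identityʳ (seq x n)))
    ; distrib =
        (λ x y z → pointwise (x *ᵣ (y +ᵣ z)) ((x *ᵣ y) +ᵣ (x *ᵣ z))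
          (λ n → ℚ.*-distribˡ-+ (seq x n) (seq y n) (seq z n)))
      , (λ x y z → pointwise ((y +ᵣ z) *ᵣ x) ((y *ᵣ x) +ᵣ (z *ᵣ x))
          (λ n → ℚ.*-distribʳ-+ (seq x n) (seq y n) (seq z n)))
    }
  ; *-comm = λ x y → pointwise (x *ᵣ y) (y *ᵣ x)
      (λ n → ℚ.*-comm (seq x n) (seq y n))
  }

ℝ-commutativeRing : CommutativeRing 0ℓ 0ℓ
ℝ-commutativeRing = record { isCommutativeRing = ℝ-isCommutativeRing }

ℂ-commutativeRing : CommutativeRing 0ℓ 0ℓ
ℂ-commutativeRing = Adjoin-i.adjoin-i ℝ-commutativeRing

------------------------------------------------------------------------
-- Polynomials in x₀, …, x_{N-1}: formal sums of terms.  The same monomial may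
-- occur several times and coefficients may be zero, so everything below
-- depends on such a list only through its coefficients.

Monomial : ℕ → Set
Monomial N = Vec ℕ N

∣_∣ₘ : ∀ {N} → Monomial N → ℕ
∣ e ∣ₘ = Vec.sum e

module Polynomials {c ℓ} (R : CommutativeRing c ℓ) where
  open CommutativeRing R using (Carrier; _≈_; _+_; _*_; 0#; 1#)

  Poly : ℕ → Set c
  Poly N = List (Carrier × Monomial N)

  module _ {N : ℕ} where

    coeff : Poly N → Monomial N → Carrier
    coeff []            e = 0#
    coeff ((a , f) ∷ P) e =
      if does (≡-dec ℕ._≟_ f e) then a + coeff P e else coeff P e

    infix 4 _≈ₚ_ _∈supp_
    infixl 6 _+ₚ_
    infixl 7 _*ₚ_

    _≈ₚ_ : Poly N → Poly N → Set ℓ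
    P ≈ₚ Q = ∀ e → coeff P e ≈ coeff Q e

    const : Carrier → Poly N
    const a = (a , replicate N 0) ∷ []

    var : Fin N → Poly N
    var w = (1# , replicate N 0 [ w ]≔ 1) ∷ []

    _+ₚ_ : Poly N → Poly N → Poly N
    _+ₚ_ = _++_

    _*ₚ_ : Poly N → Poly N → Poly N
    _*ₚ_ = cartesianProductWith (λ (a , e) (b , f) → (a * b) , zipWith ℕ._+_ e f)

    ∑ : ∀ {k} → Vector (Poly N) k → Poly N
    ∑ = Vector.foldr _+ₚ_ (const 0#)

    ∏ : ∀ {k} → Vector (Poly N) k → Poly N
    ∏ = Vector.foldr _*ₚ_ (const 1#)

    -- Over ℂ, _≈_ is undecidable but stable under double negation, so a
    -- coefficient outside the support does vanish.
    _∈supp_ : Monomial N → Poly N → Set ℓ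
    e ∈supp P = ¬ (coeff P e ≈ 0#)

    HasDegree : Poly N → ℕ → Set ℓ
    HasDegree P d =
      (∀ e → e ∈supp P → ∣ e ∣ₘ ≤ d) × (∃[ e ] e ∈supp P × ∣ e ∣ₘ ≡ d)

    Homogeneous : Poly N → Set ℓ
    Homogeneous P = ∃[ m ] (∀ e → e ∈supp P → ∣ e ∣ₘ ≡ m)

    Multilinear : Poly N → Set ℓ
    Multilinear P = ∀ e → e ∈supp P → ∀ i → lookup e i ≤ 1

    HasExactlyTerms : Poly N → ℕ → Set ℓ
    HasExactlyTerms P n =
      ∃[ S ] Unique S × length S ≡ n × (∀ e → e ∈ S ⇔ e ∈supp P)

    NonOverlapping : Poly N → Set ℓ
    NonOverlapping P = ∀ e f → e ∈supp P → f ∈supp P → e ≢ f →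
      ∀ i → ¬ (0 < lookup e i × 0 < lookup f i)

    -- The last entry of the coefficient vector is the constant term.
    affine : Vector Carrier (suc N) → Poly N
    affine h = const (h (fromℕ N)) +ₚ ∑ (λ w → const (h (inject₁ w)) *ₚ var w)

    ChowExpression : Poly N → (d ρ : ℕ) → Set (c ⊔ˡ ℓ)
    ChowExpression P d ρ =
      ∃ λ (H : Fin ρ → Fin d → Fin (suc N) → Carrier) →
        P ≈ₚ ∑ (λ u → ∏ (λ v → affine (H u v)))

    -- The number of factors per product is the degree of P.
    HasChowRank : Poly N → ℕ → Set (c ⊔ˡ ℓ)
    HasChowRank P ρ = ∃[ d ] HasDegree P d × 1 ≤ d × ChowExpression P d ρ
      × (∀ σ → ChowExpression P d σ → ρ ≤ σ)

open Polynomials ℂ-commutativeRing public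

-- Upper bound: write each term as a product of scaled variables.
-- Lower bound: the first partials of Σᵤ ∏ᵥ ℓᵤᵥ are linear combinations of the
-- σ·d products ∏_{v′≠v} ℓᵤᵥ′, so the matrix of first partials at any family of
-- points factors through a space of dimension σ·d.  For P, take the n·d
-- variables x occurring in it and, for each of them, the point at which the
-- other variables of the term of x are 1 and all remaining variables are 0.
-- Since d ≥ 2 and the terms do not overlap, the resulting matrix is diagonal
-- with nonzero entries, hence n·d ≤ σ·d.
module Submission where

open import Algebra.Bundles using (CommutativeRing)
import Algebra.Properties.Ring as RingProperties
import Algebra.Properties.Semiring.Exp as SemiringExp
import Algebra.Properties.Semiring.Sum as SemiringSum
import Algebra.Solver.Ring.NaturalCoefficients.Default as SemiringSolver
open import Data.Bool.Base using (if_then_else_)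
open import Data.Fin.Base
  using (Fin; zero; suc; fromℕ; inject₁; punchIn; combine; remQuot)
open import Data.Fin.Properties as Fin
  using (any?; punchInᵢ≢i; fromℕ≢inject₁; inject₁-injective;
         remQuot-combine; combine-remQuot; suc-injective)
open import Data.List.Base as List
  using (List; []; _∷_; _++_; length; map; deduplicate)
open import Data.List.Membership.Propositional using (_∈_)
open import Data.List.Membership.Propositional.Properties
  using (∈-lookup; ∈-map⁺; ∈-deduplicate⁺; ∈-++⁺ˡ; ∈-++⁺ʳ)
open import Data.List.Relation.Unary.All as All using (All; []; _∷_)
open import Data.List.Relation.Unary.AllPairs using ([]; _∷_)
import Data.List.Relation.Unary.Any as Any
open import Data.List.Relation.Unary.Any.Properties using (lookup-index)
open import Data.List.Relation.Unary.Unique.Propositional using (Unique)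
open import Data.List.Relation.Unary.Unique.DecPropositional.Properties
  using (deduplicate-!)
open import Data.Nat.Base as ℕ using (ℕ; zero; suc; _≤_; _<_; z≤n; s≤s)
import Data.Nat.Properties as ℕ
open import Data.Product.Base using (_×_; _,_; ∃; proj₁; proj₂; uncurry)
open import Data.Rational.Base as ℚ using (0ℚ; 1ℚ; ½; ∣_∣)
import Data.Rational.Properties as ℚ
open import Data.Rational.Solver using (module +-*-Solver)
open import Data.Sum.Base using (_⊎_; inj₁; inj₂; fromInj₁)
open import Data.Vec.Base as Vec using (Vec; []; _∷_; lookup; replicate; zipWith; _[_]≔_)
import Data.Vec.Properties as Vec
open import Data.Vec.Functional as Vector using (Vector; head; tail; insertAt)
open import Data.Vec.Functional.Properties using (insertAt-lookup; insertAt-punchIn)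
open import Function.Bundles using (Equivalence)
open import Function.Base using (_∘_)
open import Level using (_⊔_)
open import Relation.Binary.PropositionalEquality as ≡
  using (_≡_; _≢_)
open import Relation.Nullary
  using (¬_; Dec; yes; no; does; contradiction; ¬?; _×-dec_; ¬¬-map)
open import Relation.Nullary.Decidable using (¬¬-excluded-middle)
open import Defs using
  (module Adjoin-i; ℝ; seq; cauchy; fromℚ; ℝ-commutativeRing; ℂ-commutativeRing;
   module Vanishes-Properties; Monomial; ∣_∣ₘ; module Polynomials)

-- Equality on ℂ is undecidable, so a pivot cannot be searched for, and row reduction yields a
-- linear dependence only under double negation. That suffices: the bound is a decidable inequality
-- of natural numbers, proved by refuting its opposite, so the dependence is only ever used to reach
-- a contradiction. All that must be known of ℂ is that it is an integral domain whose equality is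
-- stable under double negation; no inverses are taken, and elimination cross-multiplies instead.
-- Counting partials rather than products makes both sides scale by the same `d`: a product
-- contributes `d` cofactors, a term of the polynomial contributes `d` variables. In degree one the
-- method must fail, because the partials are constants and no choice of points separates the
-- variables; indeed a nonzero linear form has Chow rank 1.

lookup-injective : ∀ {a} {A : Set a} {xs : List A} → Unique xs →
  ∀ i j → List.lookup xs i ≡ List.lookup xs j → i ≡ j
lookup-injective (_ ∷ _) zero zero _ = ≡.refl
lookup-injective (x∉ ∷ _) zero (suc j) eq = contradiction eq (All.lookup x∉ (∈-lookup j))
lookup-injective (x∉ ∷ _) (suc i) zero eq =
  contradiction (≡.sym eq) (All.lookup x∉ (∈-lookup i))
lookup-injective (_ ∷ u) (suc i) (suc j) eq = ≡.cong suc (lookup-injective u i j eq)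

-- Apartness is unavailable, so an integral domain is described by negated
-- equations; stability makes these usable.
record IsStableDomain {c ℓ} (R : CommutativeRing c ℓ) : Set (c ⊔ ℓ) where
  open CommutativeRing R hiding (zero)
  field
    stable   : ∀ {x} → ¬ ¬ (x ≈ 0#) → x ≈ 0#
    nonzero* : ∀ {x y} → x * y ≈ 0# → ¬ (x ≈ 0#) → y ≈ 0#
    1≉0      : ¬ (1# ≈ 0#)

-- Finite sums, products and indicators over a commutative ring.

module Sums {c ℓ} (R : CommutativeRing c ℓ) where
  open CommutativeRing R hiding (zero)
  open SemiringSum semiring public
  open import Relation.Binary.Reasoning.Setoid setoid

  sum-zero : ∀ {n} {f : Vector Carrier n} → (∀ i → f i ≈ 0#) → sum f ≈ 0#
  sum-zero {n} f≈0 = trans (sum-cong-≋ f≈0) (sum-replicate-zero n)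

  sum-single : ∀ {n} (f : Vector Carrier n) i → (∀ j → j ≢ i → f j ≈ 0#) → sum f ≈ f i
  sum-single {suc n} f i f≈0 = begin
    sum f                             ≈⟨ sum-remove {i = i} f ⟩
    f i + sum (Vector.removeAt f i)   ≈⟨ +-congˡ (sum-zero λ j → f≈0 _ (punchInᵢ≢i i j)) ⟩
    f i + 0#                          ≈⟨ +-identityʳ _ ⟩
    f i                               ∎

  product : ∀ {n} → Vector Carrier n → Carrier
  product = Vector.foldr _*_ 1#

  𝟙 : ∀ {a} {A : Set a} → Dec A → Carrier
  𝟙 A? = if does A? then 1# else 0#

  𝟙-yes : ∀ {a} {A : Set a} (A? : Dec A) → A → 𝟙 A? ≈ 1#
  𝟙-yes (yes _) _ = refl
  𝟙-yes (no ¬a) a = contradiction a ¬a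

  𝟙-no : ∀ {a} {A : Set a} (A? : Dec A) → ¬ A → 𝟙 A? ≈ 0#
  𝟙-no (yes a) ¬a = contradiction a ¬a
  𝟙-no (no _)  _  = refl

-- Fraction-free elimination and the rank bound.

module LinearDependence {c ℓ} (R : CommutativeRing c ℓ) (domain : IsStableDomain R) where
  open CommutativeRing R hiding (zero)
  open IsStableDomain domain
  open Sums R
  open RingProperties ring
  open SemiringSolver commutativeSemiring using (solve; _:=_; _:+_; _:*_)
  open import Relation.Binary.Reasoning.Setoid setoid

  Dependent : ∀ {p q} → (Fin p → Fin q → Carrier) → Set (c ⊔ ℓ)
  Dependent {p} A = ∃ λ (x : Vector Carrier p) →
    (∃ λ i → ¬ (x i ≈ 0#)) × (∀ k → sum (λ i → x i * A i k) ≈ 0#)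

  -- Row operation without division: the other row is first multiplied by the pivot `A i zero`, so
  -- that subtracting a multiple of the pivot row clears column `zero`.
  eliminate : ∀ {p q} → (Fin (suc p) → Fin (suc q) → Carrier) → Fin (suc p) →
    Fin p → Fin (suc q) → Carrier
  eliminate A i j k =
    A i zero * A (punchIn i j) k + - (A (punchIn i j) zero * A i k)

  eliminate-zero : ∀ {p q} (A : Fin (suc p) → Fin (suc q) → Carrier) i j →
    eliminate A i j zero ≈ 0#
  eliminate-zero A i j = trans (+-congʳ (*-comm _ _)) (-‿inverseʳ _)

  -- A relation `x` among the reduced rows lifts: undoing the cross-multiplication gives weight
  -- `a * x l` to each other row and `- s` to the pivot row. It stays nontrivial because `a` and
  -- `x j` are nonzero in a domain.
  eliminate-dependent : ∀ {p q} (A : Fin (suc p) → Fin (suc q) → Carrier) i →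
    ¬ (A i zero ≈ 0#) → Dependent (λ j → eliminate A i j ∘ suc) → Dependent A
  eliminate-dependent {p} A i a≉0 (x , (j , xj≉0) , x·A′≈0) =
    y , (punchIn i j , yj≉0) , y·A≈0
    where
    a = A i zero
    s = sum λ l → x l * A (punchIn i l) zero
    y = insertAt (λ l → a * x l) i (- s)

    yj≉0 : ¬ (y (punchIn i j) ≈ 0#)
    yj≉0 y≈0 = xj≉0 (nonzero* (trans (sym (reflexive (insertAt-punchIn _ i (- s) j))) y≈0) a≉0)

    x·A″≈0 : ∀ k → sum (λ l → x l * eliminate A i l k) ≈ 0#
    x·A″≈0 zero    = sum-zero λ l → trans (*-congˡ (eliminate-zero A i l)) (zeroʳ _)
    x·A″≈0 (suc k) = x·A′≈0 k

    y·A≈0 : ∀ k → sum (λ l → y l * A l k) ≈ 0#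
    y·A≈0 k = begin
      sum (λ l → y l * A l k)
        ≈⟨ sum-remove {i = i} (λ l → y l * A l k) ⟩
      y i * A i k + sum (λ l → y (punchIn i l) * A (punchIn i l) k)
        ≈⟨ +-cong (*-congʳ (reflexive (insertAt-lookup _ i (- s))))
             (sum-cong-≋ λ l → *-congʳ (reflexive (insertAt-punchIn _ i (- s) l))) ⟩
      - s * A i k + sum (λ l → (a * x l) * A (punchIn i l) k)
        -- The sign moves onto `A i k`, so that the semiring solver below can treat `- A i k` as an
        -- atom.
        ≈⟨ +-congʳ (trans (sym (-‿distribˡ-* s (A i k))) (-‿distribʳ-* s (A i k))) ⟩
      s * - A i k + sum (λ l → (a * x l) * A (punchIn i l) k)
        ≈⟨ +-congʳ (*-distribʳ-sum (- A i k) (λ l → x l * A (punchIn i l) zero)) ⟩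
      sum (λ l → (x l * A (punchIn i l) zero) * - A i k) + sum (λ l → (a * x l) * A (punchIn i l) k)
        ≈⟨ ∑-distrib-+ {p} _ _ ⟨
      sum (λ l → (x l * A (punchIn i l) zero) * - A i k + (a * x l) * A (punchIn i l) k)
        ≈⟨ sum-cong-≋ (λ l → trans
             (solve 5 (λ x z u a w → (x :* z) :* u :+ (a :* x) :* w := x :* (a :* w :+ z :* u)) refl
               (x l) (A (punchIn i l) zero) (- A i k) a (A (punchIn i l) k))
             (*-congˡ (+-congˡ (sym (-‿distribʳ-* _ _))))) ⟩
      sum (λ l → x l * eliminate A i l k)
        ≈⟨ x·A″≈0 k ⟩
      0# ∎

  -- Induction on the number of columns. Whether column `zero` has a pivot is decided only
  -- classically, hence the double negation; without a pivot the column vanishes by stability and is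
  -- dropped.
  dependent : ∀ {p q} (A : Fin p → Fin q → Carrier) → q < p → ¬ ¬ Dependent A
  dependent {suc p} {zero} A _ ¬dep = ¬dep ((λ _ → 1#) , (zero , 1≉0) , λ ())
  dependent {suc p} {suc q} A (s≤s q<p) ¬dep =
    ¬¬-excluded-middle {A = ∃ λ i → ¬ (A i zero ≈ 0#)} λ where
    (yes (i , a≉0)) → dependent (λ j → eliminate A i j ∘ suc) q<p
      (¬dep ∘ eliminate-dependent A i a≉0)
    (no column≈0) → dependent (λ i → A i ∘ suc) (ℕ.m<n⇒m<1+n q<p)
      λ (x , x≉0 , x·A≈0) → ¬dep (x , x≉0 , λ where
        zero    → sum-zero λ i →
          trans (*-congˡ (stable λ a≉0 → column≈0 (i , a≉0))) (zeroʳ (x i))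
        (suc k) → x·A≈0 k)

  -- With fewer inner indices than rows, the rows of `A` satisfy a relation `x`, which then also
  -- annihilates `M`. Since `M` is diagonal, column `j` reads `x j * M j j ≈ 0#`, impossible where
  -- `x j` is nonzero.
  factorization-rank : ∀ {p σ d} (A : Fin p → Fin σ → Fin d → Carrier)
    (B : Fin σ → Fin d → Fin p → Carrier) (M : Fin p → Fin p → Carrier) →
    (∀ i j → M i j ≈ sum λ u → sum λ v → A i u v * B u v j) →
    (∀ i j → i ≢ j → M i j ≈ 0#) → (∀ i → ¬ (M i i ≈ 0#)) → p ≤ σ ℕ.* d
  factorization-rank {p} {σ} {d} A B M M≈AB off diag =
    ℕ.≮⇒≥ λ σd<p → dependent (λ i → uncurry (A i) ∘ remQuot {σ} d) σd<p
      λ (x , (j , xj≉0) , x·A≈0) → diag j (nonzero* (xjMj≈0 x j x·A≈0) xj≉0)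
    where
    module _ (x : Vector Carrier p) (j : Fin p)
      (x·A≈0 : ∀ k → sum (λ i → x i * uncurry (A i) (remQuot {σ} d k)) ≈ 0#) where

      x·A≈0′ : ∀ u v → sum (λ i → x i * A i u v) ≈ 0#
      x·A≈0′ u v = ≡.subst (λ uv → sum (λ i → x i * uncurry (A i) uv) ≈ 0#)
        (remQuot-combine u v) (x·A≈0 (combine u v))

      xjMj≈0 : x j * M j j ≈ 0#
      xjMj≈0 = begin
        x j * M j j
          ≈⟨ sum-single (λ i → x i * M i j) j (λ i i≢j → trans (*-congˡ (off i j i≢j)) (zeroʳ _)) ⟨
        sum (λ i → x i * M i j)
          ≈⟨ sum-cong-≋ (λ i → trans (*-congˡ (M≈AB i j)) (trans (*-distribˡ-sum {σ} (x i) _)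
               (sum-cong-≋ {σ} λ u → trans (*-distribˡ-sum {d} (x i) _)
                 (sum-cong-≋ {d} λ v → sym (*-assoc _ _ _))))) ⟩
        sum (λ i → sum λ u → sum λ v → (x i * A i u v) * B u v j)
          ≈⟨ ∑-comm (λ i u → sum λ v → (x i * A i u v) * B u v j) ⟩
        sum (λ u → sum λ i → sum λ v → (x i * A i u v) * B u v j)
          ≈⟨ sum-cong-≋ (λ u → ∑-comm (λ i v → (x i * A i u v) * B u v j)) ⟩
        sum (λ u → sum λ v → sum λ i → (x i * A i u v) * B u v j)
          ≈⟨ sum-zero (λ u → sum-zero λ v → begin
               sum (λ i → (x i * A i u v) * B u v j)  ≈⟨ *-distribʳ-sum (B u v j) (λ i → x i * A i u v) ⟨
               sum (λ i → x i * A i u v) * B u v j    ≈⟨ *-congʳ (x·A≈0′ u v) ⟩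
               0# * B u v j                           ≈⟨ zeroˡ _ ⟩
               0#                                     ∎) ⟩
        0# ∎

-- Linear functionals on formal polynomials.

module LinearFunctionals {c ℓ} (R : CommutativeRing c ℓ) where
  open CommutativeRing R hiding (zero)
  open Sums R
  open Polynomials R
  open import Relation.Binary.Reasoning.Setoid setoid

  infixl 7 _·_
  _·_ : ∀ {N} → Monomial N → Monomial N → Monomial N
  _·_ = zipWith ℕ._+_

  one : ∀ {N} → Monomial N
  one {N} = replicate N 0

  unit : ∀ {N} → Fin N → Monomial N
  unit {N} w = replicate N 0 [ w ]≔ 1

  ·-identityˡ : ∀ {N} (e : Monomial N) → one · e ≡ e
  ·-identityˡ = Vec.zipWith-identityˡ ℕ.+-identityˡ

  -- Coefficients, values and directional derivatives all have this form, so
  -- working with arbitrary φ replaces the usual congruence laws of _≈ₚ_.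
  extend : ∀ {N} → (Monomial N → Carrier) → Poly N → Carrier
  extend φ []            = 0#
  extend φ ((a , e) ∷ P) = a * φ e + extend φ P

  module _ {N : ℕ} where

    extend-cong : ∀ {φ ψ : Monomial N → Carrier} P → (∀ e → φ e ≈ ψ e) → extend φ P ≈ extend ψ P
    extend-cong []            φ≈ψ = refl
    extend-cong ((a , e) ∷ P) φ≈ψ = +-cong (*-congˡ (φ≈ψ e)) (extend-cong P φ≈ψ)

    extend-+ₚ : ∀ φ P (Q : Poly N) → extend φ (P +ₚ Q) ≈ extend φ P + extend φ Q
    extend-+ₚ φ []            Q = sym (+-identityˡ _)
    extend-+ₚ φ ((a , e) ∷ P) Q = trans (+-congˡ (extend-+ₚ φ P Q)) (sym (+-assoc _ _ _))

    extend-scale : ∀ φ a (e : Monomial N) Q →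
      extend φ (map (λ (b , f) → (a * b) , (e · f)) Q) ≈ a * extend (λ f → φ (e · f)) Q
    extend-scale φ a e []            = sym (zeroʳ a)
    extend-scale φ a e ((b , f) ∷ Q) = begin
      (a * b) * φ (e · f) + extend φ (map (λ (b , f) → (a * b) , (e · f)) Q)
        ≈⟨ +-cong (*-assoc a b _) (extend-scale φ a e Q) ⟩
      a * (b * φ (e · f)) + a * extend (λ f → φ (e · f)) Q
        ≈⟨ distribˡ a _ _ ⟨
      a * (b * φ (e · f) + extend (λ f → φ (e · f)) Q) ∎

    extend-*ₚ : ∀ φ P (Q : Poly N) →
      extend φ (P *ₚ Q) ≈ extend (λ e → extend (λ f → φ (e · f)) Q) P
    extend-*ₚ φ []            Q = refl
    extend-*ₚ φ ((a , e) ∷ P) Q =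
      trans (extend-+ₚ φ (map (λ (b , f) → (a * b) , (e · f)) Q) (P *ₚ Q))
        (+-cong (extend-scale φ a e Q) (extend-*ₚ φ P Q))

    extend-∑ : ∀ φ {k} (F : Vector (Poly N) k) → extend φ (∑ F) ≈ sum (λ i → extend φ (F i))
    extend-∑ φ {zero}  F = trans (+-identityʳ _) (zeroˡ _)
    extend-∑ φ {suc k} F = trans (extend-+ₚ φ (F zero) _) (+-congˡ (extend-∑ φ (tail F)))

    extend-affine : ∀ φ (h : Vector Carrier (suc N)) →
      extend φ (affine h) ≈ h (fromℕ N) * φ one + sum (λ w → h (inject₁ w) * φ (unit w))
    extend-affine φ h = +-congˡ (trans (extend-∑ φ {N} _) (sum-cong-≋ {N} λ w → begin
      (h (inject₁ w) * 1#) * φ (one · unit w) + 0#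
        ≈⟨ +-identityʳ _ ⟩
      (h (inject₁ w) * 1#) * φ (one · unit w)
        ≈⟨ *-cong (*-identityʳ _) (reflexive (≡.cong φ (·-identityˡ (unit w)))) ⟩
      h (inject₁ w) * φ (unit w) ∎))

    coeff≈extend : ∀ P (e : Monomial N) →
      coeff P e ≈ extend (λ f → 𝟙 (Vec.≡-dec ℕ._≟_ f e)) P
    coeff≈extend []            e = refl
    coeff≈extend ((a , f) ∷ P) e with Vec.≡-dec ℕ._≟_ f e
    ... | yes _ = +-cong (sym (*-identityʳ a)) (coeff≈extend P e)
    ... | no  _ = trans (coeff≈extend P e)
                    (trans (sym (+-identityˡ _)) (+-congʳ (sym (zeroʳ a))))

    -- Repeated monomials are collected: each entry `(a , f)` of `P` meets exactly one index of the
    -- duplicate-free list `M`. `M` may exceed the monomials of `P`, so that two polynomials can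
    -- share one list.
    extend-support : ∀ φ P (M : List (Monomial N)) → Unique M →
      All (λ (_ , e) → e ∈ M) P →
      extend φ P ≈ sum (λ i → coeff P (List.lookup M i) * φ (List.lookup M i))
    extend-support φ [] M M! [] = sym (sum-zero {length M} λ i → zeroˡ _)
    extend-support φ ((a , f) ∷ P) M M! (f∈M ∷ P⊆M) = begin
      a * φ f + extend φ P
        ≈⟨ +-cong (sym first) (extend-support φ P M M! P⊆M) ⟩
      sum (λ i → (a * 𝟙 (f≟ i)) * φ (m i)) + sum (λ i → coeff P (m i) * φ (m i))
        ≈⟨ ∑-distrib-+ {length M} _ _ ⟨
      sum (λ i → (a * 𝟙 (f≟ i)) * φ (m i) + coeff P (m i) * φ (m i))
        ≈⟨ sum-cong-≋ {length M} (λ i → sym (distribʳ _ _ _)) ⟩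
      sum (λ i → (a * 𝟙 (f≟ i) + coeff P (m i)) * φ (m i))
        ≈⟨ sum-cong-≋ {length M} (λ i → *-congʳ (step i)) ⟩
      sum (λ i → coeff ((a , f) ∷ P) (m i) * φ (m i)) ∎
      where
      m = List.lookup M
      k = Any.index f∈M
      f≡mk = lookup-index f∈M
      f≟ : ∀ i → Dec (f ≡ m i)
      f≟ i = Vec.≡-dec ℕ._≟_ f (m i)

      first : sum (λ i → (a * 𝟙 (f≟ i)) * φ (m i)) ≈ a * φ f
      first = trans
        (sum-single {length M} _ k (λ i i≢k → trans (*-congʳ (trans (*-congˡ (𝟙-no (f≟ i)
           λ f≡mi → i≢k (lookup-injective M! i k (≡.trans (≡.sym f≡mi) f≡mk)))) (zeroʳ a))) (zeroˡ _)))
        (*-cong (trans (*-congˡ (𝟙-yes (f≟ k) f≡mk)) (*-identityʳ a))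
                (reflexive (≡.cong φ (≡.sym f≡mk))))

      step : ∀ i → a * 𝟙 (f≟ i) + coeff P (m i) ≈ coeff ((a , f) ∷ P) (m i)
      step i with f≟ i
      ... | yes _ = +-congʳ (*-identityʳ a)
      ... | no  _ = trans (+-congʳ (zeroʳ a)) (+-identityˡ _)

    -- Expanded over the joint monomials of `P` and `Q`, both sides depend on coefficients alone.
    -- This is how an equality of coefficients becomes an equality of derivatives at every point.
    extend-respects-≈ₚ : ∀ φ (P Q : Poly N) → P ≈ₚ Q → extend φ P ≈ extend φ Q
    extend-respects-≈ₚ φ P Q P≈Q = begin
      extend φ P                             ≈⟨ extend-support φ P M M! (All.tabulate P⊆M) ⟩
      sum (λ i → coeff P (m i) * φ (m i))    ≈⟨ sum-cong-≋ {length M} (λ i → *-congʳ (P≈Q (m i))) ⟩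
      sum (λ i → coeff Q (m i) * φ (m i))    ≈⟨ extend-support φ Q M M! (All.tabulate Q⊆M) ⟨
      extend φ Q                             ∎
      where
      _≟_ = Vec.≡-dec ℕ._≟_
      M = deduplicate _≟_ (map proj₂ (P ++ Q))
      m = List.lookup M
      M! = deduplicate-! _≟_ (map proj₂ (P ++ Q))
      P⊆M : ∀ {t} → t ∈ P → proj₂ t ∈ M
      P⊆M = ∈-deduplicate⁺ _≟_ ∘ ∈-map⁺ proj₂ ∘ ∈-++⁺ˡ
      Q⊆M : ∀ {t} → t ∈ Q → proj₂ t ∈ M
      Q⊆M = ∈-deduplicate⁺ _≟_ ∘ ∈-map⁺ proj₂ ∘ ∈-++⁺ʳ P

    variableForm : Carrier → Fin N → Vector Carrier (suc N)
    variableForm a w k = a * 𝟙 (k Fin.≟ inject₁ w)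

    extend-variableForm : ∀ φ a w → extend φ (affine (variableForm a w)) ≈ a * φ (unit w)
    extend-variableForm φ a w = begin
      extend φ (affine (variableForm a w))
        ≈⟨ extend-affine φ (variableForm a w) ⟩
      variableForm a w (fromℕ N) * φ one + sum (λ x → variableForm a w (inject₁ x) * φ (unit x))
        ≈⟨ +-cong (vanish (fromℕ N) one λ eq → fromℕ≢inject₁ {i = w} eq)
             (sum-single {N} _ w λ x x≢w → vanish (inject₁ x) (unit x) (x≢w ∘ inject₁-injective)) ⟩
      0# + (a * 𝟙 (inject₁ w Fin.≟ inject₁ w)) * φ (unit w)
        ≈⟨ +-identityˡ _ ⟩
      (a * 𝟙 (inject₁ w Fin.≟ inject₁ w)) * φ (unit w)
        ≈⟨ *-congʳ (trans (*-congˡ (𝟙-yes (inject₁ w Fin.≟ inject₁ w) ≡.refl)) (*-identityʳ a)) ⟩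
      a * φ (unit w) ∎
      where
      vanish : ∀ k e → k ≢ inject₁ w → variableForm a w k * φ e ≈ 0#
      vanish k e k≢w =
        trans (*-congʳ (trans (*-congˡ (𝟙-no (k Fin.≟ inject₁ w) k≢w)) (zeroʳ a))) (zeroˡ _)

    monomial : ∀ {d} → Vector (Fin N) d → Monomial N
    monomial = Vector.foldr (λ w e → unit w · e) one

    extend-∏-variableForm : ∀ φ {d} (a : Vector Carrier d) (w : Vector (Fin N) d) →
      extend φ (∏ (λ j → affine (variableForm (a j) (w j)))) ≈ product a * φ (monomial w)
    extend-∏-variableForm φ {zero}  a w = +-identityʳ _
    extend-∏-variableForm φ {suc d} a w = begin
      extend φ (∏ (λ j → affine (variableForm (a j) (w j))))
        ≈⟨ extend-*ₚ φ (affine (variableForm (a zero) (w zero))) rest ⟩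
      extend (λ e → extend (λ f → φ (e · f)) rest) (affine (variableForm (a zero) (w zero)))
        ≈⟨ extend-variableForm _ (a zero) (w zero) ⟩
      a zero * extend (λ f → φ (unit (w zero) · f)) rest
        ≈⟨ *-congˡ (extend-∏-variableForm _ (tail a) (tail w)) ⟩
      a zero * (product (tail a) * φ (unit (w zero) · monomial (tail w)))
        ≈⟨ *-assoc _ _ _ ⟨
      product a * φ (monomial w) ∎
      where rest = ∏ (λ j → affine (variableForm (tail a j) (tail w j)))

-- Evaluation, directional derivatives and the product rule.

module Gradient {c ℓ} (R : CommutativeRing c ℓ) where
  open CommutativeRing R hiding (zero)
  open Sums R
  open LinearFunctionals R
  open Polynomials R
  open SemiringExp semiring using (_^_; ^-homo-*)
  open SemiringSolver commutativeSemiring using (solve; _:=_; _:+_; _:*_)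
  open import Relation.Binary.Reasoning.Setoid setoid

  extend-linear : ∀ {N} (φ ψ : Monomial N → Carrier) a b P →
    extend (λ e → a * φ e + b * ψ e) P ≈ a * extend φ P + b * extend ψ P
  extend-linear φ ψ a b [] = sym (trans (+-cong (zeroʳ a) (zeroʳ b)) (+-identityˡ 0#))
  extend-linear φ ψ a b ((x , e) ∷ P) = trans (+-congˡ (extend-linear φ ψ a b P))
    (solve 7 (λ x a b y z u v → x :* (a :* y :+ b :* z) :+ (a :* u :+ b :* v)
                             := a :* (x :* y :+ u) :+ b :* (x :* z :+ v))
      refl x a b (φ e) (ψ e) (extend φ P) (extend ψ P))

  -- The derivative `k * p ^ (k - 1) * t` of the `k`-th power at `p` in direction `t`. Unfolding it
  -- by the product rule avoids both the subtraction and the natural-number multiple.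
  d-pow : Carrier → Carrier → ℕ → Carrier
  d-pow p t zero    = 0#
  d-pow p t (suc k) = t * p ^ k + p * d-pow p t k

  d-pow-+ : ∀ p t k l → d-pow p t (k ℕ.+ l) ≈ d-pow p t k * p ^ l + p ^ k * d-pow p t l
  d-pow-+ p t zero l =
    sym (trans (+-cong (zeroˡ _) (*-identityˡ _)) (+-identityˡ _))
  d-pow-+ p t (suc k) l = trans
    (+-cong (*-congˡ (^-homo-* p k l)) (*-congˡ (d-pow-+ p t k l)))
    (solve 6 (λ p t pᵏ pˡ dk dl → t :* (pᵏ :* pˡ) :+ p :* (dk :* pˡ :+ pᵏ :* dl)
                                := (t :* pᵏ :+ p :* dk) :* pˡ :+ (p :* pᵏ) :* dl)
      refl p t (p ^ k) (p ^ l) (d-pow p t k) (d-pow p t l))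

  eval : ∀ {N} → Vector Carrier N → Monomial N → Carrier
  eval p []      = 1#
  eval p (k ∷ e) = head p ^ k * eval (tail p) e

  deriv : ∀ {N} → Vector Carrier N → Vector Carrier N → Monomial N → Carrier
  deriv p t []      = 0#
  deriv p t (k ∷ e) =
    d-pow (head p) (head t) k * eval (tail p) e + head p ^ k * deriv (tail p) (tail t) e

  eval-· : ∀ {N} p (e f : Monomial N) → eval p (e · f) ≈ eval p e * eval p f
  eval-· p []      []      = sym (*-identityˡ 1#)
  eval-· p (k ∷ e) (l ∷ f) =
    trans (*-cong (^-homo-* (head p) k l) (eval-· (tail p) e f))
      (solve 4 (λ a b x y → (a :* b) :* (x :* y) := (a :* x) :* (b :* y)) refl
        (head p ^ k) (head p ^ l) (eval (tail p) e) (eval (tail p) f))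

  deriv-· : ∀ {N} p t (e f : Monomial N) →
    deriv p t (e · f) ≈ deriv p t e * eval p f + eval p e * deriv p t f
  deriv-· p t []      []      = sym (trans (+-cong (zeroˡ 1#) (zeroʳ 1#)) (+-identityˡ 0#))
  deriv-· p t (k ∷ e) (l ∷ f) = trans
    (+-cong (*-cong (d-pow-+ (head p) (head t) k l) (eval-· (tail p) e f))
            (*-cong (^-homo-* (head p) k l) (deriv-· (tail p) (tail t) e f)))
    (solve 8 (λ dk pˡ pᵏ dl ee ef de df →
       (dk :* pˡ :+ pᵏ :* dl) :* (ee :* ef) :+ (pᵏ :* pˡ) :* (de :* ef :+ ee :* df)
       := (dk :* ee :+ pᵏ :* de) :* (pˡ :* ef) :+ (pᵏ :* ee) :* (dl :* ef :+ pˡ :* df))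
      refl (d-pow (head p) (head t) k) (head p ^ l) (head p ^ k) (d-pow (head p) (head t) l)
      (eval (tail p) e) (eval (tail p) f) (deriv (tail p) (tail t) e) (deriv (tail p) (tail t) f))

  eval-one : ∀ {N} (p : Vector Carrier N) → eval p one ≈ 1#
  eval-one {zero}  p = refl
  eval-one {suc N} p = trans (*-identityˡ _) (eval-one (tail p))

  deriv-one : ∀ {N} (p t : Vector Carrier N) → deriv p t one ≈ 0#
  deriv-one {zero}  p t = refl
  deriv-one {suc N} p t =
    trans (+-cong (zeroˡ _) (trans (*-identityˡ _) (deriv-one (tail p) (tail t)))) (+-identityˡ 0#)

  eval-unit : ∀ {N} (p : Vector Carrier N) w → eval p (unit w) ≈ p w
  eval-unit p zero    =
    trans (*-cong (*-identityʳ _) (eval-one (tail p))) (*-identityʳ _)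
  eval-unit p (suc w) = trans (*-identityˡ _) (eval-unit (tail p) w)

  deriv-unit : ∀ {N} (p t : Vector Carrier N) w → deriv p t (unit w) ≈ t w
  deriv-unit p t zero = begin
    (head t * 1# + head p * 0#) * eval (tail p) one + head p ^ 1 * deriv (tail p) (tail t) one
      ≈⟨ +-cong (*-cong (+-cong (*-identityʳ _) (zeroʳ _)) (eval-one (tail p)))
                (trans (*-congˡ (deriv-one (tail p) (tail t))) (zeroʳ _)) ⟩
    (head t + 0#) * 1# + 0#   ≈⟨ +-identityʳ _ ⟩
    (head t + 0#) * 1#        ≈⟨ *-identityʳ _ ⟩
    head t + 0#               ≈⟨ +-identityʳ _ ⟩
    head t                    ∎
  deriv-unit p t (suc w) = trans
    (+-cong (zeroˡ _) (trans (*-identityˡ _) (deriv-unit (tail p) (tail t) w))) (+-identityˡ _)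

  evalₚ : ∀ {N} → Vector Carrier N → Poly N → Carrier
  evalₚ p = extend (eval p)

  derivₚ : ∀ {N} → Vector Carrier N → Vector Carrier N → Poly N → Carrier
  derivₚ p t = extend (deriv p t)

  evalₚ-*ₚ : ∀ {N} p (P Q : Poly N) → evalₚ p (P *ₚ Q) ≈ evalₚ p P * evalₚ p Q
  evalₚ-*ₚ p P Q = begin
    evalₚ p (P *ₚ Q)
      ≈⟨ extend-*ₚ (eval p) P Q ⟩
    extend (λ e → extend (λ f → eval p (e · f)) Q) P
      ≈⟨ extend-cong P (λ e → begin
           extend (λ f → eval p (e · f)) Q
             ≈⟨ extend-cong Q (λ f → trans (eval-· p e f) (pad _)) ⟩
           extend (λ f → eval p e * eval p f + 0# * eval p f) Q
             ≈⟨ extend-linear (eval p) (eval p) (eval p e) 0# Q ⟩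
           eval p e * evalₚ p Q + 0# * evalₚ p Q
             ≈⟨ pad _ ⟨
           eval p e * evalₚ p Q
             ≈⟨ *-comm _ _ ⟩
           evalₚ p Q * eval p e
             ≈⟨ pad _ ⟩
           evalₚ p Q * eval p e + 0# * eval p e ∎) ⟩
    extend (λ e → evalₚ p Q * eval p e + 0# * eval p e) P
      ≈⟨ extend-linear (eval p) (eval p) (evalₚ p Q) 0# P ⟩
    evalₚ p Q * evalₚ p P + 0# * evalₚ p P
      ≈⟨ pad _ ⟨
    evalₚ p Q * evalₚ p P
      ≈⟨ *-comm _ _ ⟩
    evalₚ p P * evalₚ p Q ∎
    where
    -- `extend-linear` handles combinations of two functionals; a single scalar multiple is padded
    -- with a zero summand to fit it.
    pad : ∀ {y} x → x ≈ x + 0# * y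
    pad x = sym (trans (+-congˡ (zeroˡ _)) (+-identityʳ x))

  derivₚ-*ₚ : ∀ {N} p t (P Q : Poly N) →
    derivₚ p t (P *ₚ Q) ≈ derivₚ p t P * evalₚ p Q + evalₚ p P * derivₚ p t Q
  derivₚ-*ₚ p t P Q = begin
    derivₚ p t (P *ₚ Q)
      ≈⟨ extend-*ₚ (deriv p t) P Q ⟩
    extend (λ e → extend (λ f → deriv p t (e · f)) Q) P
      ≈⟨ extend-cong P (λ e → begin
           extend (λ f → deriv p t (e · f)) Q
             ≈⟨ extend-cong Q (deriv-· p t e) ⟩
           extend (λ f → deriv p t e * eval p f + eval p e * deriv p t f) Q
             ≈⟨ extend-linear (eval p) (deriv p t) (deriv p t e) (eval p e) Q ⟩
           deriv p t e * evalₚ p Q + eval p e * derivₚ p t Q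
             ≈⟨ +-cong (*-comm _ _) (*-comm _ _) ⟩
           evalₚ p Q * deriv p t e + derivₚ p t Q * eval p e ∎) ⟩
    extend (λ e → evalₚ p Q * deriv p t e + derivₚ p t Q * eval p e) P
      ≈⟨ extend-linear (deriv p t) (eval p) (evalₚ p Q) (derivₚ p t Q) P ⟩
    evalₚ p Q * derivₚ p t P + derivₚ p t Q * evalₚ p P
      ≈⟨ +-cong (*-comm _ _) (*-comm _ _) ⟩
    derivₚ p t P * evalₚ p Q + evalₚ p P * derivₚ p t Q ∎

  evalₚ-∏ : ∀ {N} p {d} (F : Vector (Poly N) d) →
    evalₚ p (∏ F) ≈ product (λ v → evalₚ p (F v))
  evalₚ-∏ p {zero}  F = trans (+-identityʳ _) (trans (*-identityˡ _) (eval-one p))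
  evalₚ-∏ p {suc d} F =
    trans (evalₚ-*ₚ p (head F) (∏ (tail F))) (*-congˡ (evalₚ-∏ p (tail F)))

  productExcept : ∀ {d} → Vector Carrier d → Vector Carrier d
  productExcept x zero    = product (tail x)
  productExcept x (suc v) = head x * productExcept (tail x) v

  derivₚ-∏ : ∀ {N} p t {d} (F : Vector (Poly N) d) → derivₚ p t (∏ F) ≈
    sum (λ v → derivₚ p t (F v) * productExcept (λ v → evalₚ p (F v)) v)
  derivₚ-∏ p t {zero}  F = trans (+-identityʳ _) (trans (*-identityˡ _) (deriv-one p t))
  derivₚ-∏ p t {suc d} F = begin
    derivₚ p t (∏ F)
      ≈⟨ derivₚ-*ₚ p t (head F) (∏ (tail F)) ⟩
    derivₚ p t (head F) * evalₚ p (∏ (tail F)) + evalₚ p (head F) * derivₚ p t (∏ (tail F))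
      ≈⟨ +-cong (*-congˡ (evalₚ-∏ p (tail F))) (trans (*-congˡ (derivₚ-∏ p t (tail F)))
           (trans (*-distribˡ-sum {d} (evalₚ p (head F)) _)
             (sum-cong-≋ {d} λ v → solve 3 (λ x y z → x :* (y :* z) := y :* (x :* z)) refl
               (evalₚ p (head F)) (derivₚ p t (tail F v)) _))) ⟩
    sum (λ v → derivₚ p t (F v) * productExcept (λ v → evalₚ p (F v)) v) ∎

  -- The point `p` drops out of the derivative of an affine form. With the product rule, each
  -- summand of a partial is thus a factor depending on the direction times a factor depending on
  -- the point.
  derivₚ-affine : ∀ {N} p t (h : Vector Carrier (suc N)) →
    derivₚ p t (affine h) ≈ sum (λ w → h (inject₁ w) * t w)
  derivₚ-affine {N} p t h = begin
    derivₚ p t (affine h)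
      ≈⟨ extend-affine (deriv p t) h ⟩
    h (fromℕ N) * deriv p t one + sum (λ w → h (inject₁ w) * deriv p t (unit w))
      ≈⟨ +-cong (trans (*-congˡ (deriv-one p t)) (zeroʳ _))
                (sum-cong-≋ {N} λ w → *-congˡ (deriv-unit p t w)) ⟩
    0# + sum (λ w → h (inject₁ w) * t w)
      ≈⟨ +-identityˡ _ ⟩
    sum (λ w → h (inject₁ w) * t w) ∎

  product-nonzero : IsStableDomain R → ∀ {d} (x : Vector Carrier d) →
    (∀ v → ¬ (x v ≈ 0#)) → ¬ (product x ≈ 0#)
  product-nonzero domain {zero}  x x≉0 = IsStableDomain.1≉0 domain
  product-nonzero domain {suc d} x x≉0 Πx≈0 = product-nonzero domain (tail x) (x≉0 ∘ suc)
    (IsStableDomain.nonzero* domain Πx≈0 (x≉0 zero))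

  product-zero : ∀ {d} (x : Vector Carrier d) v → x v ≈ 0# → product x ≈ 0#
  product-zero x zero    x≈0 = trans (*-congʳ x≈0) (zeroˡ _)
  product-zero x (suc v) x≈0 = trans (*-congˡ (product-zero (tail x) v x≈0)) (zeroʳ _)

  productExcept-zero : ∀ {d} (x : Vector Carrier d) {u v} → u ≢ v → x u ≈ 0# →
    productExcept x v ≈ 0#
  productExcept-zero x {zero}  {zero}  u≢v x≈0 = contradiction ≡.refl u≢v
  productExcept-zero x {zero}  {suc v} u≢v x≈0 = trans (*-congʳ x≈0) (zeroˡ _)
  productExcept-zero x {suc u} {zero}  u≢v x≈0 = product-zero (tail x) u x≈0
  productExcept-zero x {suc u} {suc v} u≢v x≈0 =
    trans (*-congˡ (productExcept-zero (tail x) (u≢v ∘ ≡.cong suc) x≈0)) (zeroʳ _)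

  productExcept-nonzero : IsStableDomain R → ∀ {d} (x : Vector Carrier d) v →
    (∀ u → u ≢ v → ¬ (x u ≈ 0#)) → ¬ (productExcept x v ≈ 0#)
  productExcept-nonzero domain x zero    x≉0 =
    product-nonzero domain (tail x) (λ u → x≉0 (suc u) λ ())
  productExcept-nonzero domain x (suc v) x≉0 Πx≈0 =
    productExcept-nonzero domain (tail x) v (λ u u≢v → x≉0 (suc u) (u≢v ∘ suc-injective))
      (IsStableDomain.nonzero* domain Πx≈0 (x≉0 zero λ ()))

  productExcept-cong : ∀ {d} {x y : Vector Carrier d} v → (∀ u → x u ≈ y u) →
    productExcept x v ≈ productExcept y v
  productExcept-cong zero    x≈y = product-cong (x≈y ∘ suc)
    where
    product-cong : ∀ {d} {x y : Vector Carrier d} → (∀ u → x u ≈ y u) → product x ≈ product y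
    product-cong {zero}  x≈y = refl
    product-cong {suc d} x≈y = *-cong (x≈y zero) (product-cong (x≈y ∘ suc))
  productExcept-cong (suc v) x≈y = *-cong (x≈y zero) (productExcept-cong v (x≈y ∘ suc))

-- The diagonal matrix of partials and the lower bound.

module LowerBound {c ℓ} (R : CommutativeRing c ℓ) (domain : IsStableDomain R) where
  open CommutativeRing R hiding (zero)
  open IsStableDomain domain
  open Sums R
  open LinearDependence R domain using (factorization-rank)
  open LinearFunctionals R
  open Gradient R
  open Polynomials R
  open import Relation.Binary.Reasoning.Setoid setoid

  derivₚ-chow : ∀ {N n d} p t (F : Fin n → Fin d → Poly N) →
    derivₚ p t (∑ (λ u → ∏ (F u))) ≈
    sum (λ u → sum λ v → derivₚ p t (F u v) * productExcept (λ v → evalₚ p (F u v)) v)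
  derivₚ-chow {n = n} p t F =
    trans (extend-∑ (deriv p t) (λ u → ∏ (F u))) (sum-cong-≋ {n} λ u → derivₚ-∏ p t (F u))

  another : ∀ {d} → 2 ≤ d → (j : Fin d) → ∃ λ k → k ≢ j
  another (s≤s (s≤s _)) j = punchIn j zero , punchInᵢ≢i j zero

  module _ {N n d : ℕ} (2≤d : 2 ≤ d)
    (a : Fin n → Fin d → Carrier) (a≉0 : ∀ i j → ¬ (a i j ≈ 0#))
    (w : Fin n → Fin d → Fin N)
    (w-injective : ∀ i j k l → w i j ≡ w k l → (i , j) ≡ (k , l)) where

    forms : Fin n → Fin d → Poly N
    forms i j = affine (variableForm (a i j) (w i j))

    direction : Fin n × Fin d → Vector Carrier N
    direction (i , j) x = 𝟙 (x Fin.≟ w i j)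

    others? : ∀ i j x → Dec (∃ λ k → k ≢ j × w i k ≡ x)
    others? i j x = any? λ k → ¬? (k Fin.≟ j) ×-dec (w i k Fin.≟ x)

    -- The variables of the i-th term other than the j-th are set to 1, all
    -- others to 0: of the first partials of the polynomial, exactly the one
    -- with respect to w i j survives here.
    point : Fin n × Fin d → Vector Carrier N
    point (i , j) x = 𝟙 (others? i j x)

    entry : Fin n × Fin d → Fin n × Fin d → Carrier
    entry r s = derivₚ (point s) (direction r) (∑ (λ i → ∏ (forms i)))

    cofactor : Fin n × Fin d → Fin n → Fin d → Carrier
    cofactor s u = productExcept λ v → a u v * point s (w u v)

    -- The variable `w i j` occurs in no form but `forms i j`, so a single summand of the product
    -- rule survives.
    entry≈ : ∀ i j s → entry (i , j) s ≈ a i j * cofactor s i j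
    entry≈ i j s = begin
      entry (i , j) s
        ≈⟨ derivₚ-chow (point s) t forms ⟩
      sum (λ u → sum λ v → derivₚ (point s) t (forms u v) *
        productExcept (λ v → evalₚ (point s) (forms u v)) v)
        ≈⟨ sum-cong-≋ {n} (λ u → sum-cong-≋ {d} λ v → *-cong (dform u v)
             (productExcept-cong v λ v → trans (extend-variableForm (eval (point s)) (a u v) (w u v))
               (*-congˡ (eval-unit (point s) (w u v))))) ⟩
      sum (λ u → sum λ v → (a u v * t (w u v)) * cofactor s u v)
        ≈⟨ sum-single {n} _ i (λ u u≢i → sum-zero {d} λ v → away u v (u≢i ∘ ≡.cong proj₁)) ⟩
      sum (λ v → (a i v * t (w i v)) * cofactor s i v)
        ≈⟨ sum-single {d} _ j (λ v v≢j → away i v (v≢j ∘ ≡.cong proj₂)) ⟩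
      (a i j * t (w i j)) * cofactor s i j
        ≈⟨ *-congʳ (trans (*-congˡ (𝟙-yes (w i j Fin.≟ w i j) ≡.refl)) (*-identityʳ _)) ⟩
      a i j * cofactor s i j ∎
      where
      t = direction (i , j)
      dform : ∀ u v → derivₚ (point s) t (forms u v) ≈ a u v * t (w u v)
      dform u v = trans (extend-variableForm _ (a u v) (w u v))
        (*-congˡ (deriv-unit (point s) t (w u v)))
      away : ∀ u v → (u , v) ≢ (i , j) → (a u v * t (w u v)) * cofactor s u v ≈ 0#
      away u v uv≢ij = trans (*-congʳ (trans (*-congˡ (𝟙-no (w u v Fin.≟ w i j)
        (uv≢ij ∘ w-injective u v i j))) (zeroʳ _))) (zeroˡ _)

    cofactor-zero : ∀ s u v k → k ≢ v → point s (w u k) ≈ 0# → cofactor s u v ≈ 0#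
    cofactor-zero s u v k k≢v p≈0 =
      productExcept-zero _ k≢v (trans (*-congˡ p≈0) (zeroʳ _))

    -- For different terms, the point of term `k` kills every variable of term `i`, and `2 ≤ d`
    -- leaves a factor besides the omitted `j`. Within one term, the point kills `w k l`, whose
    -- factor is still present because `l` differs from `j`.
    cofactor-off : ∀ i j k l → (i , j) ≢ (k , l) → cofactor (k , l) i j ≈ 0#
    cofactor-off i j k l ij≢kl with i Fin.≟ k
    ... | no i≢k = cofactor-zero (k , l) i j (proj₁ (another 2≤d j)) (proj₂ (another 2≤d j))
      (𝟙-no (others? k l _) λ (m , _ , eq) →
        i≢k (≡.sym (≡.cong proj₁ (w-injective k m i _ eq))))
    ... | yes ≡.refl = cofactor-zero (k , l) k j l (λ l≡j → ij≢kl (≡.cong (k ,_) (≡.sym l≡j)))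
      (𝟙-no (others? k l _) λ (m , m≢l , eq) → m≢l (≡.cong proj₂ (w-injective k m k l eq)))

    cofactor-diag : ∀ i j → ¬ (cofactor (i , j) i j ≈ 0#)
    cofactor-diag i j = productExcept-nonzero domain _ j λ k k≢j ap≈0 →
      1≉0 (trans (sym (𝟙-yes (others? i j (w i k)) (k , k≢j , ≡.refl)))
        (nonzero* ap≈0 (a≉0 i k)))

    terms≤products : ∀ {σ} (H : Fin σ → Fin d → Vector Carrier (suc N)) →
      ∑ (λ i → ∏ (forms i)) ≈ₚ ∑ (λ u → ∏ (λ v → affine (H u v))) → n ≤ σ
    terms≤products {σ} H forms≈H = ℕ.*-cancelʳ-≤ n σ d {{ℕ.>-nonZero (ℕ.<⇒≤ 2≤d)}}
      (factorization-rank A B (λ r s → entry (ix r) (ix s)) entry≈AB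
        (λ r s r≢s → trans (entry≈ (row r) (col r) (ix s))
          (trans (*-congˡ (cofactor-off (row r) (col r) (row s) (col s) (r≢s ∘ ix-injective r s)))
            (zeroʳ _)))
        (λ r M≈0 → cofactor-diag (row r) (col r)
          (nonzero* (trans (sym (entry≈ (row r) (col r) (ix r))) M≈0) (a≉0 (row r) (col r)))))
      where
      ix : Fin (n ℕ.* d) → Fin n × Fin d
      ix = remQuot d
      ix-injective : ∀ r s → ix r ≡ ix s → r ≡ s
      ix-injective r s eq = ≡.trans (≡.sym (combine-remQuot {n} d r))
        (≡.trans (≡.cong (uncurry combine) eq) (combine-remQuot {n} d s))
      row = proj₁ ∘ ix
      col = proj₂ ∘ ix
      -- The inner index is the pair `(u , v)`: `A` sees only the direction attached to a row, `B`
      -- only the point attached to a column.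
      A : Fin (n ℕ.* d) → Fin σ → Fin d → Carrier
      A r u v = sum λ x → H u v (inject₁ x) * direction (ix r) x
      B : Fin σ → Fin d → Fin (n ℕ.* d) → Carrier
      B u v s = productExcept (λ v → evalₚ (point (ix s)) (affine (H u v))) v
      entry≈AB : ∀ r s → entry (ix r) (ix s) ≈ sum λ u → sum λ v → A r u v * B u v s
      entry≈AB r s = begin
        entry (ix r) (ix s)
          ≈⟨ extend-respects-≈ₚ _ (∑ (λ i → ∏ (forms i))) (∑ (λ u → ∏ (λ v → affine (H u v)))) forms≈H ⟩
        derivₚ (point (ix s)) (direction (ix r)) (∑ (λ u → ∏ (λ v → affine (H u v))))
          ≈⟨ derivₚ-chow (point (ix s)) (direction (ix r)) (λ u v → affine (H u v)) ⟩
        sum (λ u → sum λ v →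
          derivₚ (point (ix s)) (direction (ix r)) (affine (H u v)) * B u v s)
          ≈⟨ sum-cong-≋ {σ} (λ u → sum-cong-≋ {d} λ v →
               *-congʳ {B u v s} (derivₚ-affine (point (ix s)) (direction (ix r)) (H u v))) ⟩
        sum (λ u → sum λ v → A r u v * B u v s) ∎

-- Factoring the terms of the polynomial and the exact rank.

module ChowRank {c ℓ} (R : CommutativeRing c ℓ) (domain : IsStableDomain R) where
  open CommutativeRing R hiding (zero)
  open IsStableDomain domain
  open Sums R
  open LinearFunctionals R
  open LowerBound R domain
  open Polynomials R
  open import Relation.Binary.Reasoning.Setoid setoid

  -- Lists the variables of `e` in increasing order, each repeated according to its exponent; the
  -- index type makes the number of factors equal to the degree.
  variables : ∀ {N} (e : Monomial N) → Fin ∣ e ∣ₘ → Fin N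
  variables (zero  ∷ e) k       = suc (variables e k)
  variables (suc a ∷ e) zero    = zero
  variables (suc a ∷ e) (suc k) = variables (a ∷ e) k

  monomial-suc : ∀ {N d} (w : Vector (Fin N) d) → monomial (suc ∘ w) ≡ 0 ∷ monomial w
  monomial-suc {d = zero}  w = ≡.refl
  monomial-suc {d = suc d} w = ≡.cong (unit (suc (w zero)) ·_) (monomial-suc (tail w))

  monomial-variables : ∀ {N} (e : Monomial N) → monomial (variables e) ≡ e
  monomial-variables []          = ≡.refl
  monomial-variables (zero  ∷ e) =
    ≡.trans (monomial-suc (variables e)) (≡.cong (0 ∷_) (monomial-variables e))
  monomial-variables (suc a ∷ e) = ≡.trans
    (≡.cong (unit zero ·_) (monomial-variables (a ∷ e)))
    (≡.cong (suc a ∷_) (·-identityˡ e))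

  variables-positive : ∀ {N} (e : Monomial N) k → 0 < lookup e (variables e k)
  variables-positive (zero  ∷ e) k       = variables-positive e k
  variables-positive (suc a ∷ e) zero    = s≤s z≤n
  variables-positive (suc a ∷ e) (suc k) =
    ℕ.<-≤-trans (variables-positive (a ∷ e) k) (lookup-mono (variables (a ∷ e) k))
    where
    lookup-mono : ∀ x → lookup (a ∷ e) x ≤ lookup (suc a ∷ e) x
    lookup-mono zero    = ℕ.n≤1+n a
    lookup-mono (suc x) = ℕ.≤-refl

  variables-injective : ∀ {N} (e : Monomial N) → (∀ i → lookup e i ≤ 1) →
    ∀ k l → variables e k ≡ variables e l → k ≡ l
  variables-injective (zero ∷ e) e≤1 k l eq =
    variables-injective e (e≤1 ∘ suc) k l (suc-injective eq)
  variables-injective (suc (suc a) ∷ e) e≤1 k l eq with s≤s () ← e≤1 zero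
  variables-injective (suc zero ∷ e) e≤1 zero    zero    eq = ≡.refl
  variables-injective (suc zero ∷ e) e≤1 (suc k) (suc l) eq =
    ≡.cong suc (variables-injective e (e≤1 ∘ suc) k l (suc-injective eq))

  -- Having `d` as a parameter confines the equation `∣ e ∣ₘ ≡ d` to `factorization`, so all terms
  -- get factors indexed by the same `Fin d` without transports.
  record Factorization {N} (e : Monomial N) (d : ℕ) : Set where
    field
      factor     : Vector (Fin N) d
      monomial≡e : monomial factor ≡ e
      positive   : ∀ k → 0 < lookup e (factor k)
      injective  : ∀ k l → factor k ≡ factor l → k ≡ l

  factorization : ∀ {N d} (e : Monomial N) → ∣ e ∣ₘ ≡ d → (∀ i → lookup e i ≤ 1) →
    Factorization e d
  factorization e ≡.refl e≤1 = record
    { factor     = variables e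
    ; monomial≡e = monomial-variables e
    ; positive   = variables-positive e
    ; injective  = variables-injective e e≤1
    }

  -- The coefficient of a term is carried by its first factor alone, which requires at least one
  -- factor.
  scaledOnes : ∀ {d} → Carrier → Vector Carrier (suc d)
  scaledOnes a zero    = a
  scaledOnes a (suc _) = 1#

  scaledOnes-nonzero : ∀ {d a} → ¬ (a ≈ 0#) → ∀ (j : Fin (suc d)) → ¬ (scaledOnes a j ≈ 0#)
  scaledOnes-nonzero a≉0 zero    = a≉0
  scaledOnes-nonzero a≉0 (suc j) = 1≉0

  product-scaledOnes : ∀ d a → product {suc d} (scaledOnes a) ≈ a
  product-scaledOnes d a = trans (*-congˡ (product-ones d)) (*-identityʳ a)
    where
    product-ones : ∀ d → product {d} (λ _ → 1#) ≈ 1#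
    product-ones zero    = refl
    product-ones (suc d) = trans (*-identityˡ _) (product-ones d)

  hasChowRank : ∀ {N n d} (P : Poly N) → Homogeneous P → Multilinear P →
    HasExactlyTerms P n → HasDegree P d → 2 ≤ d → NonOverlapping P → HasChowRank P n
  hasChowRank {N} {d = suc (suc d)} P (m , ∣∣≡m) multilinear (S , S! , ≡.refl , ∈S⇔∈supp)
    hasDegree@(_ , f , f∈P , ∣f∣≡d) (s≤s (s≤s z≤n)) disjoint =
    suc (suc d) , hasDegree , s≤s z≤n , (H , P≈forms) , λ σ (K , P≈K) →
      terms≤products (s≤s (s≤s z≤n)) a a≉0 w w-injective K
        (λ g → trans (sym (P≈forms g)) (P≈K g))
    where
    n = length S

    e : Fin n → Monomial N
    e = List.lookup S

    e∈P : ∀ i → e i ∈supp P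
    e∈P i = Equivalence.to (∈S⇔∈supp (e i)) (∈-lookup i)

    -- The common degree `m` of the terms equals `d`, because the term `f` attains `d`.
    module F i = Factorization (factorization (e i)
      (≡.trans (∣∣≡m (e i) (e∈P i)) (≡.trans (≡.sym (∣∣≡m f f∈P)) ∣f∣≡d))
      (multilinear (e i) (e∈P i)))

    w : Fin n → Fin (suc (suc d)) → Fin N
    w = F.factor

    w-injective : ∀ i j k l → w i j ≡ w k l → (i , j) ≡ (k , l)
    w-injective i j k l eq with i Fin.≟ k
    ... | yes ≡.refl = ≡.cong (i ,_) (F.injective i j l eq)
    ... | no  i≢k    = contradiction
      (F.positive i j , ≡.subst (λ x → 0 < lookup (e k) x) (≡.sym eq) (F.positive k l))
      (disjoint (e i) (e k) (e∈P i) (e∈P k) (i≢k ∘ lookup-injective S! i k) (w i j))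

    a : Fin n → Fin (suc (suc d)) → Carrier
    a i = scaledOnes (coeff P (e i))

    a≉0 : ∀ i j → ¬ (a i j ≈ 0#)
    a≉0 i = scaledOnes-nonzero (e∈P i)

    H : Fin n → Fin (suc (suc d)) → Vector Carrier (suc N)
    H i j = variableForm (a i j) (w i j)

    products : Poly N
    products = ∑ (λ i → ∏ (λ j → affine (H i j)))

    _≟_ : (g h : Monomial N) → Dec (g ≡ h)
    _≟_ = Vec.≡-dec ℕ._≟_

    coeff-products : ∀ g → coeff products g ≈ sum (λ i → coeff P (e i) * 𝟙 (e i ≟ g))
    coeff-products g = begin
      coeff products g
        ≈⟨ coeff≈extend products g ⟩
      extend (λ h → 𝟙 (h ≟ g)) products
        ≈⟨ extend-∑ _ (λ i → ∏ (λ j → affine (H i j))) ⟩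
      sum (λ i → extend (λ h → 𝟙 (h ≟ g)) (∏ (λ j → affine (H i j))))
        ≈⟨ sum-cong-≋ {n} (λ i → trans (extend-∏-variableForm _ (a i) (w i))
             (*-cong (product-scaledOnes (suc d) (coeff P (e i)))
               (reflexive (≡.cong (λ h → 𝟙 (h ≟ g)) (F.monomial≡e i))))) ⟩
      sum (λ i → coeff P (e i) * 𝟙 (e i ≟ g)) ∎

    P≈forms : P ≈ₚ products
    P≈forms g with Any.any? (g ≟_) S
    ... | yes g∈S = begin
      coeff P g                                ≡⟨ ≡.cong (coeff P) g≡ek ⟩
      coeff P (e k)                            ≈⟨ *-identityʳ _ ⟨
      coeff P (e k) * 1#                       ≈⟨ *-congˡ (𝟙-yes (e k ≟ g) (≡.sym g≡ek)) ⟨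
      coeff P (e k) * 𝟙 (e k ≟ g)              ≈⟨ sum-single {n} _ k (λ i i≢k → trans
                                                    (*-congˡ (𝟙-no (e i ≟ g) λ ei≡g → i≢k
                                                      (lookup-injective S! i k (≡.trans ei≡g g≡ek))))
                                                    (zeroʳ _)) ⟨
      sum (λ i → coeff P (e i) * 𝟙 (e i ≟ g))  ≈⟨ coeff-products g ⟨
      coeff products g                         ∎
      where
      k = Any.index g∈S
      g≡ek = lookup-index g∈S
    -- Not being listed in `S` only says that the coefficient is not nonzero; stability turns this
    -- into vanishing.
    ... | no g∉S = begin
      coeff P g                                ≈⟨ stable (g∉S ∘ Equivalence.from (∈S⇔∈supp g)) ⟩
      0#                                       ≈⟨ sum-zero {n} (λ i → trans
                                                    (*-congˡ (𝟙-no (e i ≟ g) λ ei≡g → g∉S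
                                                      (≡.subst (_∈ S) ei≡g (∈-lookup i))))
                                                    (zeroʳ _)) ⟨
      sum (λ i → coeff P (e i) * 𝟙 (e i ≟ g))  ≈⟨ coeff-products g ⟨
      coeff products g                         ∎

-- The reals form a stable, formally real domain.

module RealDomain where
  open CommutativeRing ℝ-commutativeRing using (_≈_; _+_; _*_; 0#)
  open Vanishes-Properties using (½-pos; ½+½)

  -- `Apart` is a positive witness of being nonzero: an eventual lower bound, which can be
  -- multiplied, unlike a mere negated equation.
  Null Apart : ℝ → Set
  Null x  = ∀ ε → 0ℚ ℚ.< ε → ∃ λ k → ∀ n → k ≤ n → ∣ seq x n ∣ ℚ.< ε
  Apart x = ∃ λ δ → 0ℚ ℚ.< δ × ∃ λ k → ∀ n → k ≤ n → δ ℚ.≤ ∣ seq x n ∣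

  ≈0⇒null : ∀ x → x ≈ 0# → Null x
  ≈0⇒null x x≈0 ε ε>0 with x≈0 ε ε>0
  ... | k , x< = k , λ n k≤n →
    ≡.subst (λ q → ∣ q ∣ ℚ.< ε) (ℚ.+-identityʳ (seq x n)) (x< n k≤n)

  null⇒≈0 : ∀ x → Null x → x ≈ 0#
  null⇒≈0 x x→0 ε ε>0 with x→0 ε ε>0
  ... | k , x< = k , λ n k≤n →
    ≡.subst (λ q → ∣ q ∣ ℚ.< ε) (≡.sym (ℚ.+-identityʳ (seq x n))) (x< n k≤n)

  ∣∣-near : ∀ p q {α β} → ∣ p ℚ.- q ∣ ℚ.< α → ∣ q ∣ ℚ.< β → ∣ p ∣ ℚ.< α ℚ.+ β
  ∣∣-near p q {α} {β} p-q<α q<β = begin-strict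
    ∣ p ∣                      ≡⟨ ≡.cong ∣_∣ (split p q) ⟩
    ∣ (p ℚ.- q) ℚ.+ q ∣        ≤⟨ ℚ.∣p+q∣≤∣p∣+∣q∣ (p ℚ.- q) q ⟩
    ∣ p ℚ.- q ∣ ℚ.+ ∣ q ∣      <⟨ ℚ.+-mono-< p-q<α q<β ⟩
    α ℚ.+ β                    ∎
    where
    open ℚ.≤-Reasoning
    open +-*-Solver using (solve; _:+_; _:-_; _:=_)
    split : ∀ p q → p ≡ (p ℚ.- q) ℚ.+ q
    split = solve 2 (λ p q → p := (p :- q) :+ q) ≡.refl

  -- Although `x ≈ 0#` is undecidable, this dichotomy at a fixed precision is settled by one
  -- rational comparison, at an index beyond which the sequence varies by less than `δ`.
  eventually-small-or-apart : ∀ x ε → 0ℚ ℚ.< ε →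
    (∃ λ k → ∀ n → k ≤ n → ∣ seq x n ∣ ℚ.< ε) ⊎ Apart x
  eventually-small-or-apart x ε ε>0 = test (cauchy x δ δ>0)
    where
    -- The threshold is `η = ε/2` and the oscillation `δ = ε/4`: below the threshold later entries
    -- stay under `δ + η ≤ ε`, and otherwise they are at least `δ`, since `δ + δ = η`.
    η = ½ ℚ.* ε
    δ = ½ ℚ.* η
    δ>0 : 0ℚ ℚ.< δ
    δ>0 = ½-pos (½-pos ε>0)
    δ+η≤ε : δ ℚ.+ η ℚ.≤ ε
    δ+η≤ε = begin
      δ ℚ.+ η            ≡⟨ ≡.cong (ℚ._+ η) (ℚ.+-identityʳ δ) ⟨
      (δ ℚ.+ 0ℚ) ℚ.+ η   ≤⟨ ℚ.+-monoˡ-≤ η (ℚ.+-monoʳ-≤ δ (ℚ.<⇒≤ δ>0)) ⟩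
      (δ ℚ.+ δ) ℚ.+ η    ≡⟨ ≡.cong (ℚ._+ η) (½+½ η) ⟩
      η ℚ.+ η            ≡⟨ ½+½ ε ⟩
      ε                  ∎
      where open ℚ.≤-Reasoning
    test : ∃ (λ k → ∀ m n → k ≤ m → k ≤ n → ∣ seq x m ℚ.- seq x n ∣ ℚ.< δ) →
      (∃ λ k → ∀ n → k ≤ n → ∣ seq x n ∣ ℚ.< ε) ⊎ Apart x
    test (k , close) with ∣ seq x k ∣ ℚ.<? η
    ... | yes xk<η = inj₁ (k , λ n k≤n → ℚ.<-≤-trans
      (∣∣-near (seq x n) (seq x k) (close n k k≤n ℕ.≤-refl) xk<η) δ+η≤ε)
    ... | no  xk≮η = inj₂ (δ , δ>0 , k , λ n k≤n → ℚ.≮⇒≥ λ xn<δ → xk≮η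
      (≡.subst (∣ seq x k ∣ ℚ.<_) (½+½ η)
        (∣∣-near (seq x k) (seq x n) (close k n ℕ.≤-refl k≤n) xn<δ)))

  ¬apart⇒≈0 : ∀ x → ¬ Apart x → x ≈ 0#
  ¬apart⇒≈0 x ¬apart = null⇒≈0 x λ ε ε>0 →
    fromInj₁ (λ apart → contradiction apart ¬apart) (eventually-small-or-apart x ε ε>0)

  apart⇒≉0 : ∀ x → Apart x → ¬ (x ≈ 0#)
  apart⇒≉0 x (δ , δ>0 , k , δ≤x) x≈0 with ≈0⇒null x x≈0 δ δ>0
  ... | l , x<δ =
    ℚ.<-irrefl ≡.refl (ℚ.<-≤-trans (x<δ (k ℕ.⊔ l) (ℕ.m≤n⊔m k l)) (δ≤x (k ℕ.⊔ l) (ℕ.m≤m⊔n k l)))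

  ≈0-stable : ∀ x → ¬ ¬ (x ≈ 0#) → x ≈ 0#
  ≈0-stable x ¬x≉0 = ¬apart⇒≈0 x (¬x≉0 ∘ apart⇒≉0 x)

  apart-* : ∀ x y → Apart x → Apart y → Apart (x * y)
  apart-* x y (δ , δ>0 , k , δ≤x) (ε , ε>0 , l , ε≤y) =
    δ ℚ.* ε , δε>0 , k ℕ.⊔ l , λ n n≥ → begin
      δ ℚ.* ε                      ≤⟨ ℚ.*-monoˡ-≤-nonNeg δ (ε≤y n (ℕ.m⊔n≤o⇒n≤o k l n≥)) ⟩
      δ ℚ.* ∣ seq y n ∣            ≤⟨ ℚ.*-monoʳ-≤-nonNeg ∣ seq y n ∣ {{ℚ.∣-∣-nonNeg (seq y n)}}
                                        (δ≤x n (ℕ.m⊔n≤o⇒m≤o k l n≥)) ⟩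
      ∣ seq x n ∣ ℚ.* ∣ seq y n ∣  ≡⟨ ℚ.∣p*q∣≡∣p∣*∣q∣ (seq x n) (seq y n) ⟨
      ∣ seq x n ℚ.* seq y n ∣      ∎
    where
    open ℚ.≤-Reasoning
    instance
      δ-pos : ℚ.Positive δ
      δ-pos = ℚ.positive δ>0
      δ-nonNeg : ℚ.NonNegative δ
      δ-nonNeg = ℚ.pos⇒nonNeg δ
    δε>0 : 0ℚ ℚ.< δ ℚ.* ε
    δε>0 = ≡.subst (ℚ._< δ ℚ.* ε) (ℚ.*-zeroʳ δ) (ℚ.*-monoʳ-<-pos δ ε>0)

  isStableDomain : IsStableDomain ℝ-commutativeRing
  isStableDomain = record
    { stable   = λ {x} → ≈0-stable x
    -- Both factors may be assumed apart from 0, as each conclusion is reached by refuting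
    -- apartness; then the product is apart too.
    ; nonzero* = λ {x} {y} xy≈0 x≉0 → ¬apart⇒≈0 y λ y-apart → x≉0 (¬apart⇒≈0 x λ x-apart →
        apart⇒≉0 (x * y) (apart-* x y x-apart y-apart) xy≈0)
    ; 1≉0      = apart⇒≉0 (fromℚ 1ℚ) (1ℚ , ℚ.positive⁻¹ 1ℚ , 0 , λ _ _ → ℚ.≤-refl)
    }

  p*p-nonNeg : ∀ p → 0ℚ ℚ.≤ p ℚ.* p
  p*p-nonNeg p = ℚ.∣p∣≡p⇒0≤p (≡.trans (ℚ.∣p*q∣≡∣p∣*∣q∣ p p) (square (ℚ.∣p∣≡p∨∣p∣≡-p p)))
    where
    open +-*-Solver using (solve; _:*_; :-_; _:=_)
    square : ∣ p ∣ ≡ p ⊎ ∣ p ∣ ≡ ℚ.- p → ∣ p ∣ ℚ.* ∣ p ∣ ≡ p ℚ.* p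
    square (inj₁ eq) = ≡.cong₂ ℚ._*_ eq eq
    square (inj₂ eq) = ≡.trans (≡.cong₂ ℚ._*_ eq eq)
      (solve 1 (λ p → :- p :* :- p := p :* p) ≡.refl p)

  -- The square of `x` is squeezed between 0 and the vanishing sum, whereas `x` apart from 0 would
  -- make its square apart.
  x*x+y*y≈0⇒x≈0 : ∀ x y → x * x + y * y ≈ 0# → x ≈ 0#
  x*x+y*y≈0⇒x≈0 x y x²+y²≈0 = ¬apart⇒≈0 x λ x-apart →
    apart⇒≉0 (x * x) (apart-* x x x-apart x-apart) (null⇒≈0 (x * x) x²→0)
    where
    open ℚ.≤-Reasoning
    x²→0 : Null (x * x)
    x²→0 ε ε>0 with ≈0⇒null (x * x + y * y) x²+y²≈0 ε ε>0
    ... | k , small = k , λ n k≤n → let p = seq x n; q = seq y n in begin-strict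
      ∣ p ℚ.* p ∣                ≡⟨ ℚ.0≤p⇒∣p∣≡p (p*p-nonNeg p) ⟩
      p ℚ.* p                    ≡⟨ ℚ.+-identityʳ (p ℚ.* p) ⟨
      p ℚ.* p ℚ.+ 0ℚ             ≤⟨ ℚ.+-monoʳ-≤ (p ℚ.* p) (p*p-nonNeg q) ⟩
      p ℚ.* p ℚ.+ q ℚ.* q        ≤⟨ p≤∣p∣ (p ℚ.* p ℚ.+ q ℚ.* q) ⟩
      ∣ p ℚ.* p ℚ.+ q ℚ.* q ∣    <⟨ small n k≤n ⟩
      ε                          ∎
      where
      p≤∣p∣ : ∀ p → p ℚ.≤ ∣ p ∣
      p≤∣p∣ p with ℚ.≤-total 0ℚ p
      ... | inj₁ 0≤p = ℚ.≤-reflexive (≡.sym (ℚ.0≤p⇒∣p∣≡p 0≤p))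
      ... | inj₂ p≤0 = ℚ.≤-trans p≤0 (ℚ.0≤∣p∣ p)

-- Passage from a formally real domain to its extension by i.

module AdjoinDomain {c ℓ} (R : CommutativeRing c ℓ) (domain : IsStableDomain R) where
  open CommutativeRing R
  open IsStableDomain domain
  open RingProperties ring using (x∙y⁻¹≈ε⇒x≈y)
  open SemiringSolver commutativeSemiring using (solve; _:=_; _:+_; _:*_)

  FormallyReal : Set (c ⊔ ℓ)
  FormallyReal = ∀ x y → x * x + y * y ≈ 0# → x ≈ 0#

  -- Multiplying `z * w ≈ 0` by the conjugate of `z` leaves the norm `a * a + b * b` times each
  -- component of `w`, and formal reality makes that norm nonzero.
  adjoin-i-isStableDomain : FormallyReal → IsStableDomain (Adjoin-i.adjoin-i R)
  adjoin-i-isStableDomain real = record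
    { stable   = λ ¬¬≈0 → stable (¬¬-map proj₁ ¬¬≈0) , stable (¬¬-map proj₂ ¬¬≈0)
    ; nonzero* = λ {(a , b)} {(c , d)} (ac-bd≈0 , ad+bc≈0) z≉0 →
        nonzero* (norm*re a b c d ac-bd≈0 ad+bc≈0) (norm≉0 z≉0) ,
        nonzero* (norm*im a b c d ac-bd≈0 ad+bc≈0) (norm≉0 z≉0)
    ; 1≉0      = 1≉0 ∘ proj₁
    }
    where
    norm≉0 : ∀ {a b} → ¬ ((a ≈ 0#) × (b ≈ 0#)) → ¬ (a * a + b * b ≈ 0#)
    norm≉0 {a} {b} z≉0 N≈0 =
      z≉0 (real a b N≈0 , real b a (trans (+-comm (b * b) (a * a)) N≈0))

    -- This is `a * (ac - bd) + b * (ad + bc)` rearranged; the first hypothesis enters as `ac ≈ bd`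
    -- because the semiring solver handles no subtraction.
    norm*re : ∀ a b c d → a * c + - (b * d) ≈ 0# → a * d + b * c ≈ 0# →
      (a * a + b * b) * c ≈ 0#
    norm*re a b c d ac-bd≈0 ad+bc≈0 = trans
      (solve 3 (λ a b c → (a :* a :+ b :* b) :* c := a :* (a :* c) :+ b :* (b :* c)) refl a b c)
      (trans (+-congʳ (*-congˡ (x∙y⁻¹≈ε⇒x≈y _ _ ac-bd≈0)))
        (trans (solve 4 (λ a b c d → a :* (b :* d) :+ b :* (b :* c) := b :* (a :* d :+ b :* c))
                  refl a b c d)
          (trans (*-congˡ ad+bc≈0) (zeroʳ b))))

    norm*im : ∀ a b c d → a * c + - (b * d) ≈ 0# → a * d + b * c ≈ 0# →
      (a * a + b * b) * d ≈ 0#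
    norm*im a b c d ac-bd≈0 ad+bc≈0 = trans
      (solve 3 (λ a b d → (a :* a :+ b :* b) :* d := a :* (a :* d) :+ b :* (b :* d)) refl a b d)
      (trans (+-congˡ (*-congˡ (sym (x∙y⁻¹≈ε⇒x≈y _ _ ac-bd≈0))))
        (trans (solve 4 (λ a b c d → a :* (a :* d) :+ b :* (a :* c) := a :* (a :* d :+ b :* c))
                  refl a b c d)
          (trans (*-congˡ ad+bc≈0) (zeroʳ a))))

ℂ-isStableDomain : IsStableDomain ℂ-commutativeRing
ℂ-isStableDomain = AdjoinDomain.adjoin-i-isStableDomain ℝ-commutativeRing
  RealDomain.isStableDomain RealDomain.x*x+y*y≈0⇒x≈0

open import Defs

lemma3p8 : ∀ (N n d : ℕ) (P : Poly N) →
    1 ≤ n →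
    Homogeneous P →
    Multilinear P →
    HasExactlyTerms P n →
    HasDegree P d →
    2 ≤ d →
    NonOverlapping P →
    HasChowRank P n
lemma3p8 N n d P _ homogeneous multilinear terms degree 2≤d disjoint =
  ChowRank.hasChowRank ℂ-commutativeRing ℂ-isStableDomain
    P homogeneous multilinear terms degree 2≤d disjoint
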